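{- For all constants $0<\eta\ll\alpha\ll 1$ (that is: for every sufficiently small $\alpha>0$ there is $\eta_0=\eta_0(\alpha)>0$ such that for every $0<\eta<\eta_0$) there is an integer $n_0$ such that the following holds. If $H$ is a $3$-uniform hypergraph on $n\geq n_0$ vertices with $$\delta_1(H)\geq\left(\frac59-10\eta\right)\binom{n}{2},$$ then either $H$ contains a matching leaving strictly fewer than $\eta^2 n$ vertices uncovered, or $H$ is $\alpha$-extremal.
   Context: For a $3$-uniform hypergraph $H$, $\delta_1(H)$ is the minimum over vertices $v$ of the number of edges containing $v$. A matching is a set of pairwise disjoint edges. For $U\subseteq V(H)$, $H|_U$ is the subhypergraph induced on $U$ and $d_3(U)=|E(H|_U)|/\binom{|U|}{3}$. For $0<\alpha<1$, $H$ is called $\alpha$-extremal if there exists $B\subseteq V(H)$ with $|B|\geq\left(\frac23-\alpha\right)n$ and $d_3(B)<\alpha$.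
   Formalization: The constants α and η are taken to be rational numbers instead of arbitrary real numbers. -}

module Defs where

open import Data.Bool using (Bool; true; false; _∧_)
open import Data.Nat using (ℕ; zero; suc; _∸_) renaming (_*_ to _*ℕ_)
open import Data.Nat.Combinatorics using (_C_)
open import Data.Fin using (Fin)
open import Data.Fin.Subset using (Subset; _∈_; _⊆_; _∩_; ⋃; ∁; ∣_∣; ⊥)
open import Data.Fin.Subset.Properties using (_∈?_; _⊆?_)
open import Data.Vec using ([]; _∷_)
open import Data.List using (List; []; _∷_; _++_; map; filterᵇ; length)
open import Data.List.Relation.Unary.All using (All)
open import Data.List.Relation.Unary.AllPairs using (AllPairs)
open import Data.Integer using (+_)
open import Data.Rational using (ℚ; _/_; _*_; _-_; _<_; _≤_)
open import Data.Product using (Σ; _×_)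
open import Relation.Binary.PropositionalEquality using (_≡_)
open import Relation.Nullary.Decidable using (does)

ℕ→ℚ : ℕ → ℚ
ℕ→ℚ k = + k / 1

allSubsets : (n : ℕ) → List (Subset n)
allSubsets zero    = [] ∷ []
allSubsets (suc n) = map (false ∷_) (allSubsets n) ++ map (true ∷_) (allSubsets n)

record Hypergraph3 (n : ℕ) : Set where
  field
    edge    : Subset n → Bool
    uniform : ∀ S → edge S ≡ true → ∣ S ∣ ≡ 3
open Hypergraph3 public

edges : ∀ {n} → Hypergraph3 n → List (Subset n)
edges {n} H = filterᵇ (edge H) (allSubsets n)

deg : ∀ {n} → Hypergraph3 n → Fin n → ℕ
deg H v = length (filterᵇ (λ S → does (v ∈? S)) (edges H))

MinDegAtLeast : ∀ {n} → Hypergraph3 n → ℚ → Set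
MinDegAtLeast H d = ∀ v → d ≤ ℕ→ℚ (deg H v)

inducedEdges : ∀ {n} → Hypergraph3 n → Subset n → ℕ
inducedEdges H U = length (filterᵇ (λ S → does (S ⊆? U)) (edges H))

Disjoint : ∀ {n} → Subset n → Subset n → Set
Disjoint p q = p ∩ q ≡ ⊥

IsMatching : ∀ {n} → Hypergraph3 n → List (Subset n) → Set
IsMatching H M = All (λ S → edge H S ≡ true) M × AllPairs Disjoint M

uncovered : ∀ {n} → List (Subset n) → ℕ
uncovered M = ∣ ∁ (⋃ M) ∣

HasAlmostPerfectMatching : ∀ {n} → Hypergraph3 n → ℚ → Set
HasAlmostPerfectMatching H x =
  Σ (List (Subset _)) λ M → IsMatching H M × ℕ→ℚ (uncovered M) < x

-- H is α-extremal: ∃ B, |B| ≥ (2/3 − α) n and d₃(B) < α,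
-- where d₃(B) < α is written |E(H|_B)| < α · C(|B|,3) (cleared denominator).
Extremal : ∀ {n} → Hypergraph3 n → ℚ → Set
Extremal {n} H α =
  Σ (Subset n) λ B →
    ((+ 2 / 3 - α) * ℕ→ℚ n ≤ ℕ→ℚ ∣ B ∣) ×
    (ℕ→ℚ (inducedEdges H B) < α * ℕ→ℚ (∣ B ∣ C 3))

{-# OPTIONS --safe #-}
-- Let M be a maximum matching, L the set of vertices it leaves uncovered, and suppose |L| is
-- linear in n.  Let Γ be the graph of the pairs that lie in at least six edges with third vertex
-- in L.  Then no k edges of M (k ≤ 5) can contain k + 1 disjoint Γ-pairs, since these would extend
-- to k + 1 disjoint edges of H.
--
-- For e, f ∈ M this rules out a perfect matching in the 3 × 3 graph Γ(e,f), which leaves three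
-- possibilities: at most 4 pairs; a "cross" of 5 pairs (one vertex of e joined to all of f and one
-- vertex of f joined to all of e); or an "arc" of 5 or 6 pairs (one vertex of e joined to all of f
-- and a second one to at least two vertices of f, or the reverse).  Two edges of M never have three
-- common arc sources, so by the Kővári–Sós–Turán argument there are only o(n²) arcs.  Summing the
-- degrees over L, the bound 5/9 forces all but O(η n²) pairs of M to be crosses and forces L to be
-- small.  Three mutual crosses have consistent centres, so nearly all edges of M receive a centre;
-- the non-centres form the set B of about 2n/3 vertices.  An edge of H inside B over three edges of
-- M with mutual crosses would augment M, hence B spans o(n³) + O(η n³) edges.
module Submission where

open import Defs
open import Data.Bool using (Bool; true; false; not; _∧_; _∨_; T)
import Data.Bool.Properties as Bool
open import Data.Empty using (⊥; ⊥-elim)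
open import Data.Fin using (Fin; zero; suc) renaming (_≟_ to _≟ꟳ_)
open import Data.Fin.Properties using (all?; any?)
open import Data.Fin.Subset using (Subset; ⁅_⁆; _∪_; ∁; ⋃; ∣_∣) renaming (⊥ to ∅; _∈_ to _∈ₛ_; _∉_ to _∉ₛ_)
open import Data.Fin.Subset.Properties using (_∈?_; _⊆?_; ∪-comm; ∪-assoc; ∪-idem; ∪-identityˡ; ∪-identityʳ; ∣⁅x⁆∣≡1; x∈⁅x⁆; x∈⁅y⁆⇒x≡y; x∈p∪q⁺; x∈p∪q⁻; x∈p∩q⁻; ∉⊥; Empty-unique)
import Data.Integer as ℤ
import Data.Integer.Properties as ℤ
open import Data.List using (List; []; _∷_; _++_; map; length; filterᵇ; allFin; concatMap; take)
import Data.List as List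
open import Data.List.Properties using (length-++; length-map; length-take; length-tabulate; map-tabulate)
open import Data.List.Membership.Propositional using (_∈_; _∉_)
open import Data.List.Membership.Propositional.Properties using (∈-allFin; ∈-map⁺; ∈-map⁻; ∈-++⁺ˡ; ∈-++⁺ʳ; ∈-concat⁺′; ∈-lookup)
open import Data.List.Relation.Unary.All as All using (All; []; _∷_)
import Data.List.Relation.Unary.All.Properties as All
open import Data.List.Relation.Unary.AllPairs as AllPairs using (AllPairs; []; _∷_)
import Data.List.Relation.Unary.AllPairs.Properties as AllPairs
open import Data.List.Relation.Unary.Any using (here; there)
open import Data.List.Relation.Unary.Unique.Propositional using (Unique)
import Data.List.Relation.Unary.Unique.Propositional.Properties as Unique
open import Data.Nat using (ℕ; zero; suc; _+_; _*_; _≤_; _<_; _≥_; z≤n; s≤s; _≡ᵇ_; _≤ᵇ_; _≤?_; >-nonZero)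
open import Data.Nat.Combinatorics using (_C_; nCk+nC[k+1]≡[n+1]C[k+1]; nC1≡n)
open import Data.Nat.Properties hiding (_≤?_)
open import Algebra.Properties.CommutativeSemigroup +-commutativeSemigroup using (interchange)
open import Data.Nat.Tactic.RingSolver using (solve-∀)
open import Data.Product using (Σ; ∃; _×_; _,_; proj₁; proj₂)
import Data.Product.Properties as Product
import Data.Rational as ℚ
open ℚ using (ℚ; mkℚ; 0ℚ; 1ℚ; toℚᵘ)
import Data.Rational.Properties as ℚ
open import Data.Rational.Solver using (module +-*-Solver)
import Data.Rational.Unnormalised as ℚᵘ
open ℚᵘ using (mkℚᵘ; *≡*; *≤*)
import Data.Rational.Unnormalised.Properties as ℚᵘ
open import Data.Sum using (_⊎_; inj₁; inj₂)
open import Data.Unit using (tt)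
open import Data.Vec using (Vec; []; _∷_; here; there; lookup)
import Data.Vec as Vec
open import Data.Vec.Properties using (≡-dec; ∷-injectiveʳ; lookup-map; lookup∘tabulate; []=⇒lookup)
open import Function using (_∘_)
open import Relation.Binary.Definitions using (DecidableEquality)
open import Relation.Binary.PropositionalEquality
open import Relation.Nullary using (¬_; Dec; yes; no; does; contradiction; ¬?)
open import Relation.Nullary.Decidable using (from-yes; True; toWitness; map′; _→-dec_; _×-dec_; T?)
open import Relation.Unary using (Decidable)

-- The degree sum closes only because of the edges with two vertices in L. Put m = |M|, ℓ = |L|, so
-- n = ℓ + 3 m. Counting ordered pairs, a vertex of L must have degree about 5/9 n² = 5 m² + (10/3)
-- m ℓ + (5/9) ℓ². Pairs inside M supply about 5 m² once arcs are negligible. Edges with two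
-- vertices in L might supply up to 6 m ℓ, which is too much. But two disjoint ones at different
-- vertices of the same edge of M could replace it, so essentially one vertex per edge carries them
-- and they supply only about 2 m ℓ. What remains, (4/3) m ℓ + (5/9) ℓ², is slack. A non-cross costs
-- one more unit of the 5 m², so the number of non-crosses and ℓ² are bounded together by the error
-- terms. The error is of order n²/K with K = k², where k is a large multiple of 1/α. Three sources
-- have to stay below it: the loss 10 η, which fixes η₀; the arcs; and the terms of lower order. The
-- last two fix n₀, and for them ℓ must be linear in n, which is what failure of the first
-- alternative provides.

private variable
  A A′ : Set
  n : ℕ

-- Finite sums

⟦_⟧ : Bool → ℕ
⟦ false ⟧ = 0
⟦ true ⟧  = 1

⟦⟧≤1 : ∀ b → ⟦ b ⟧ ≤ 1
⟦⟧≤1 false = z≤n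
⟦⟧≤1 true  = s≤s z≤n

∑ : List A → (A → ℕ) → ℕ
∑ []       f = 0
∑ (x ∷ xs) f = f x + ∑ xs f

∑-cong : ∀ (xs : List A) {f g : A → ℕ} → (∀ x → f x ≡ g x) → ∑ xs f ≡ ∑ xs g
∑-cong []       h = refl
∑-cong (x ∷ xs) h = cong₂ _+_ (h x) (∑-cong xs h)

∑-mono-∈ : ∀ (xs : List A) {f g : A → ℕ} → (∀ x → x ∈ xs → f x ≤ g x) → ∑ xs f ≤ ∑ xs g
∑-mono-∈ []       h = z≤n
∑-mono-∈ (x ∷ xs) h = +-mono-≤ (h x (here refl)) (∑-mono-∈ xs (λ y → h y ∘ there))

∑-mono : ∀ (xs : List A) {f g : A → ℕ} → (∀ x → f x ≤ g x) → ∑ xs f ≤ ∑ xs g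
∑-mono xs h = ∑-mono-∈ xs (λ x _ → h x)

∑-+ : ∀ (xs : List A) (f g : A → ℕ) → ∑ xs (λ x → f x + g x) ≡ ∑ xs f + ∑ xs g
∑-+ []       f g = refl
∑-+ (x ∷ xs) f g = trans (cong (f x + g x +_) (∑-+ xs f g)) (interchange (f x) (g x) _ _)

∑-*ˡ : ∀ (xs : List A) c (f : A → ℕ) → ∑ xs (λ x → c * f x) ≡ c * ∑ xs f
∑-*ˡ []       c f = sym (*-zeroʳ c)
∑-*ˡ (x ∷ xs) c f = trans (cong (c * f x +_) (∑-*ˡ xs c f)) (sym (*-distribˡ-+ c (f x) _))

∑-*ʳ : ∀ (xs : List A) c (f : A → ℕ) → ∑ xs (λ x → f x * c) ≡ ∑ xs f * c
∑-*ʳ []       c f = refl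
∑-*ʳ (x ∷ xs) c f = trans (cong (f x * c +_) (∑-*ʳ xs c f)) (sym (*-distribʳ-+ c (f x) _))

∑-const : ∀ (xs : List A) c → ∑ xs (λ _ → c) ≡ length xs * c
∑-const []       c = refl
∑-const (x ∷ xs) c = cong (c +_) (∑-const xs c)

∑-bound : ∀ (xs : List A) {f : A → ℕ} {c} → (∀ x → x ∈ xs → f x ≤ c) → ∑ xs f ≤ length xs * c
∑-bound xs {c = c} h = ≤-trans (∑-mono-∈ xs h) (≤-reflexive (∑-const xs c))

∑-zero : ∀ (xs : List A) {f : A → ℕ} → (∀ x → x ∈ xs → f x ≡ 0) → ∑ xs f ≡ 0
∑-zero []       h = refl
∑-zero (x ∷ xs) h = cong₂ _+_ (h x (here refl)) (∑-zero xs (λ y → h y ∘ there))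

∑-swap : ∀ (xs : List A) (ys : List A′) (f : A → A′ → ℕ) →
         ∑ xs (λ x → ∑ ys (f x)) ≡ ∑ ys (λ y → ∑ xs (λ x → f x y))
∑-swap []       ys f = sym (∑-zero ys (λ _ _ → refl))
∑-swap (x ∷ xs) ys f =
  trans (cong (∑ ys (f x) +_) (∑-swap xs ys f)) (sym (∑-+ ys (f x) _))

∑-++ : ∀ (xs ys : List A) (f : A → ℕ) → ∑ (xs ++ ys) f ≡ ∑ xs f + ∑ ys f
∑-++ []       ys f = refl
∑-++ (x ∷ xs) ys f = trans (cong (f x +_) (∑-++ xs ys f)) (sym (+-assoc (f x) _ _))

∑-map : ∀ (g : A → A′) (xs : List A) (f : A′ → ℕ) → ∑ (map g xs) f ≡ ∑ xs (f ∘ g)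
∑-map g []       f = refl
∑-map g (x ∷ xs) f = cong (f (g x) +_) (∑-map g xs f)

∑-concatMap : ∀ (g : A → List A′) (xs : List A) (f : A′ → ℕ) →
              ∑ (concatMap g xs) f ≡ ∑ xs (λ x → ∑ (g x) f)
∑-concatMap g []       f = refl
∑-concatMap g (x ∷ xs) f = trans (∑-++ (g x) _ f) (cong (∑ (g x) f +_) (∑-concatMap g xs f))

∑-filterᵇ : ∀ (p : A → Bool) (xs : List A) (f : A → ℕ) →
            ∑ (filterᵇ p xs) f ≡ ∑ xs (λ x → ⟦ p x ⟧ * f x)
∑-filterᵇ p []       f = refl
∑-filterᵇ p (x ∷ xs) f with p x
... | true  = cong₂ _+_ (sym (+-identityʳ (f x))) (∑-filterᵇ p xs f)
... | false = ∑-filterᵇ p xs f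

length≡∑ : ∀ (xs : List A) → length xs ≡ ∑ xs (λ _ → 1)
length≡∑ xs = sym (trans (∑-const xs 1) (*-identityʳ _))

∈⇒≤∑ : ∀ {xs : List A} {x} (f : A → ℕ) → x ∈ xs → f x ≤ ∑ xs f
∈⇒≤∑ f (here refl) = m≤m+n _ _
∈⇒≤∑ {xs = y ∷ ys} f (there p) = ≤-trans (∈⇒≤∑ f p) (m≤n+m _ (f y))

∈∈⇒+≤∑ : ∀ {xs : List A} {x y} (f : A → ℕ) → x ∈ xs → y ∈ xs → x ≢ y → f x + f y ≤ ∑ xs f
∈∈⇒+≤∑ f (here refl) (here refl) x≢y = contradiction refl x≢y
∈∈⇒+≤∑ f (here refl) (there q)   x≢y = +-monoʳ-≤ (f _) (∈⇒≤∑ f q)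
∈∈⇒+≤∑ {x = x} {y} f (there p) (here refl) x≢y =
  ≤-trans (≤-reflexive (+-comm (f x) (f y))) (+-monoʳ-≤ (f y) (∈⇒≤∑ f p))
∈∈⇒+≤∑ {xs = z ∷ _} f (there p) (there q) x≢y =
  ≤-trans (∈∈⇒+≤∑ f p q x≢y) (m≤n+m _ (f z))

∑-pos⇒∃ : ∀ (xs : List A) (f : A → ℕ) → 0 < ∑ xs f → ∃ λ x → x ∈ xs × 0 < f x
∑-pos⇒∃ (x ∷ xs) f h with f x in eq
... | suc k = x , here refl , subst (0 <_) (sym eq) (s≤s z≤n)
... | zero  with ∑-pos⇒∃ xs f h
...   | y , y∈ , p = y , there y∈ , p

∃-≤average : ∀ (xs : List A) (f : A → ℕ) → 0 < length xs →
             ∃ λ x → x ∈ xs × length xs * f x ≤ ∑ xs f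
∃-≤average (x ∷ [])      f _ = x , here refl , ≤-refl
∃-≤average (x ∷ y ∷ ys)  f _ with ∃-≤average (y ∷ ys) f (s≤s z≤n)
... | z , z∈ , h with f x ≤? f z
...   | yes p = x , here refl , +-monoʳ-≤ (f x) (≤-trans (*-monoʳ-≤ (length (y ∷ ys)) p) h)
...   | no ¬p = z , there z∈ , +-mono-≤ (<⇒≤ (≰⇒> ¬p)) h

module _ (_≟ᴬ_ : DecidableEquality A) where

  δ : A → A → ℕ
  δ x y = ⟦ does (x ≟ᴬ y) ⟧

  δ-refl : ∀ x → δ x x ≡ 1
  δ-refl x with x ≟ᴬ x
  ... | yes _ = refl
  ... | no ¬p = contradiction refl ¬p

  δ-≢ : ∀ {x y} → x ≢ y → δ x y ≡ 0
  δ-≢ {x} {y} x≢y with x ≟ᴬ y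
  ... | yes p = contradiction p x≢y
  ... | no _  = refl

  ∑-δ≤1 : ∀ {xs} → Unique xs → ∀ a → ∑ xs (λ x → δ x a) ≤ 1
  ∑-δ≤1 [] a = z≤n
  ∑-δ≤1 {x ∷ xs} (px ∷ u) a with x ≟ᴬ a
  ... | no _     = ∑-δ≤1 u a
  ... | yes refl = ≤-reflexive (cong suc
        (∑-zero xs (λ y y∈ → δ-≢ (λ y≡x → All.lookup px y∈ (sym y≡x)))))

  ∑-δ : ∀ {xs} → Unique xs → ∀ {a} → a ∈ xs → ∀ (f : A → ℕ) → ∑ xs (λ x → δ x a * f x) ≡ f a
  ∑-δ {x ∷ xs} (px ∷ u) (here refl) f =
    trans (cong₂ _+_ (trans (cong (_* f x) (δ-refl x)) (+-identityʳ (f x)))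
                     (∑-zero xs (λ y y∈ → cong (_* f y) (δ-≢ (λ y≡x → All.lookup px y∈ (sym y≡x))))))
          (+-identityʳ (f x))
  ∑-δ {x ∷ xs} (px ∷ u) {a} (there p) f =
    trans (cong (_+ ∑ xs (λ y → δ y a * f y)) (cong (_* f x) (δ-≢ (All.lookup px p)))) (∑-δ u p f)

-- Graphs between two triples

pattern 0F = zero
pattern 1F = suc zero
pattern 2F = suc (suc zero)
pattern 3F = suc (suc (suc zero))
pattern 4F = suc (suc (suc (suc zero)))

∀₃ ∃₃ : (Fin 3 → Bool) → Bool
∀₃ f = f 0F ∧ f 1F ∧ f 2F
∃₃ f = f 0F ∨ f 1F ∨ f 2F

∀₃-elim : ∀ f → ∀₃ f ≡ true → ∀ i → f i ≡ true
∀₃-elim f h i with f 0F in e0 | f 1F in e1 | f 2F in e2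
∀₃-elim f h 0F | true | true | true = e0
∀₃-elim f h 1F | true | true | true = e1
∀₃-elim f h 2F | true | true | true = e2

∃₃-elim : ∀ f → ∃₃ f ≡ true → ∃ λ i → f i ≡ true
∃₃-elim f h with f 0F in e0 | f 1F in e1 | f 2F in e2
... | true  | _     | _    = 0F , e0
... | false | true  | _    = 1F , e1
... | false | false | true = 2F , e2

∧-elim : ∀ {a b} → a ∧ b ≡ true → a ≡ true × b ≡ true
∧-elim {a} {b} h = Bool.∧-conicalˡ a b h , Bool.∧-conicalʳ a b h

-- The diagonal is filled with the successor modulo 3, so that `other` gets an index different from
-- its argument.
third : Fin 3 → Fin 3 → Fin 3
third 0F 1F = 2F
third 1F 0F = 2F
third 0F 2F = 1F
third 2F 0F = 1F
third 1F 2F = 0F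
third 2F 1F = 0F
third 0F 0F = 1F
third 1F 1F = 2F
third 2F 2F = 0F

-- For u ≠ w these are exactly the six permutations. They serve to search for perfect matchings and
-- to rename the vertices of an edge so that two distinguished ones get the indices 0 and 1.
label : Fin 3 → Fin 3 → Fin 3 → Fin 3
label u w 0F = u
label u w 1F = w
label u w 2F = third u w

InjectiveOn₃ : (Fin 3 → Fin 3) → Set
InjectiveOn₃ ρ = ∀ i j → ρ i ≡ ρ j → i ≡ j

label-injective : ∀ {u w} → u ≢ w → InjectiveOn₃ (label u w)
label-injective {u} {w} = from-yes
  (all? λ u → all? λ w → ¬? (u ≟ꟳ w) →-dec
    (all? λ i → all? λ j → (label u w i ≟ꟳ label u w j) →-dec (i ≟ꟳ j))) u w

other : Fin 3 → Fin 3
other u = third u u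

other-≢ : ∀ u → u ≢ other u
other-≢ = from-yes (all? λ u → ¬? (u ≟ꟳ other u))

Graph₃ : Set
Graph₃ = Fin 3 → Fin 3 → Bool

_ᵀ : Graph₃ → Graph₃
(γ ᵀ) i j = γ j i

size : Graph₃ → ℕ
size γ = ∑ (allFin 3) λ i → ∑ (allFin 3) λ j → ⟦ γ i j ⟧

crossᵇ : Graph₃ → Fin 3 → Fin 3 → Bool
crossᵇ γ a c = ∀₃ (λ j → γ a j) ∧ ∀₃ (λ i → γ i c)

_≠ᵇ_ : Fin 3 → Fin 3 → Bool
i ≠ᵇ j = not (does (i ≟ꟳ j))

arcᵇ : Graph₃ → Fin 3 → Fin 3 → Fin 3 → Bool
arcᵇ γ u w s = (u ≠ᵇ w) ∧ ∀₃ (λ j → γ u j) ∧ ∀₃ (λ j → does (j ≟ꟳ s) ∨ γ w j)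

record Cross (γ : Graph₃) (a c : Fin 3) : Set where
  field
    row : ∀ j → γ a j ≡ true
    col : ∀ i → γ i c ≡ true

-- `missed` may still be adjacent to `part`, so five and six pairs are covered alike.
record Arc (γ : Graph₃) : Set where
  field
    full part missed : Fin 3
    full≢part : full ≢ part
    full-adj  : ∀ j → γ full j ≡ true
    part-adj  : ∀ j → j ≢ missed → γ part j ≡ true

≠ᵇ⇒≢ : ∀ {i j} → (i ≠ᵇ j) ≡ true → i ≢ j
≠ᵇ⇒≢ {i} {j} h with i ≟ꟳ j
... | no ¬p = ¬p

graph₃ : Vec Bool 9 → Graph₃
graph₃ (a ∷ b ∷ c ∷ _) 0F = lookup (a ∷ b ∷ c ∷ [])
graph₃ (_ ∷ _ ∷ _ ∷ a ∷ b ∷ c ∷ _) 1F = lookup (a ∷ b ∷ c ∷ [])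
graph₃ (_ ∷ _ ∷ _ ∷ _ ∷ _ ∷ _ ∷ a ∷ b ∷ c ∷ []) 2F = lookup (a ∷ b ∷ c ∷ [])

∀ᴮ : ∀ k → (Vec Bool k → Bool) → Bool
∀ᴮ zero    f = f []
∀ᴮ (suc k) f = ∀ᴮ k (f ∘ (true ∷_)) ∧ ∀ᴮ k (f ∘ (false ∷_))

∀ᴮ-elim : ∀ k f → ∀ᴮ k f ≡ true → ∀ v → f v ≡ true
∀ᴮ-elim zero    f h [] = h
∀ᴮ-elim (suc k) f h (true ∷ v)  = ∀ᴮ-elim k _ (proj₁ (∧-elim h)) v
∀ᴮ-elim (suc k) f h (false ∷ v) = ∀ᴮ-elim k _ (proj₂ (∧-elim {∀ᴮ k (f ∘ (true ∷_))} h)) v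

∃₃-cong : ∀ {f g} → (∀ i → f i ≡ g i) → ∃₃ f ≡ ∃₃ g
∃₃-cong h = cong₂ _∨_ (h 0F) (cong₂ _∨_ (h 1F) (h 2F))

∀₃-cong : ∀ {f g} → (∀ i → f i ≡ g i) → ∀₃ f ≡ ∀₃ g
∀₃-cong h = cong₂ _∧_ (h 0F) (cong₂ _∧_ (h 1F) (h 2F))

abstract
  hasCross : Graph₃ → Bool
  hasCross γ = ∃₃ λ a → ∃₃ λ c → crossᵇ γ a c

  hasArc : Graph₃ → Bool
  hasArc γ = ∃₃ λ u → ∃₃ λ w → ∃₃ λ s → arcᵇ γ u w s

  hasPerfect : Graph₃ → Bool
  hasPerfect γ = ∃₃ λ u → ∃₃ λ w → (u ≠ᵇ w) ∧ ∀₃ (λ i → γ i (label u w i))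

  hasCross⇒Cross : ∀ γ → hasCross γ ≡ true → ∃ λ a → ∃ λ c → Cross γ a c
  hasCross⇒Cross γ h with ∃₃-elim _ h
  ... | a , h₁ with ∃₃-elim _ h₁
  ...   | c , h₂ with ∧-elim {∀₃ (λ j → γ a j)} h₂
  ...     | r , s = a , c , record { row = ∀₃-elim (λ j → γ a j) r ; col = ∀₃-elim (λ i → γ i c) s }

  hasArc⇒Arc : ∀ γ → hasArc γ ≡ true → Arc γ
  hasArc⇒Arc γ h with ∃₃-elim _ h
  ... | u , h₁ with ∃₃-elim _ h₁
  ...   | w , h₂ with ∃₃-elim _ h₂
  ...     | s , h₃ with ∧-elim {u ≠ᵇ w} h₃
  ...       | p , h₄ with ∧-elim {∀₃ (λ j → γ u j)} h₄
  ...         | q , r = record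
    { full = u ; part = w ; missed = s
    ; full≢part = ≠ᵇ⇒≢ p
    ; full-adj = ∀₃-elim (λ j → γ u j) q
    ; part-adj = λ j j≢s → lem j j≢s (∀₃-elim (λ j → does (j ≟ꟳ s) ∨ γ w j) r j) }
    where
    lem : ∀ j → j ≢ s → does (j ≟ꟳ s) ∨ γ w j ≡ true → γ w j ≡ true
    lem j j≢s h with j ≟ꟳ s
    ... | yes p = contradiction p j≢s
    ... | no _  = h

  hasPerfect⇒ : ∀ γ → hasPerfect γ ≡ true →
    ∃ λ σ → InjectiveOn₃ σ × ∀ i → γ i (σ i) ≡ true
  hasPerfect⇒ γ h with ∃₃-elim _ h
  ... | u , h₁ with ∃₃-elim _ h₁
  ...   | w , h₂ with ∧-elim {u ≠ᵇ w} h₂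
  ...     | p , q = label u w , label-injective (≠ᵇ⇒≢ p) , ∀₃-elim (λ i → γ i (label u w i)) q

  hasArc-cong : ∀ {γ γ′ : Graph₃} → (∀ i j → γ i j ≡ γ′ i j) → hasArc γ ≡ hasArc γ′
  hasArc-cong h = ∃₃-cong λ u → ∃₃-cong λ w → ∃₃-cong λ s →
    cong ((u ≠ᵇ w) ∧_) (cong₂ _∧_ (∀₃-cong (h u)) (∀₃-cong λ j → cong (does (j ≟ꟳ s) ∨_) (h w j)))

-- König's theorem is behind this bound: without a perfect matching all pairs lie on two lines of
-- the 3 × 3 grid. A row and a column hold at most 5, and 5 only as a cross. Two rows hold at most
-- 6, and more than 4 only as an arc. Two columns are the transposed case.
sizeBound : Graph₃ → ℕ
sizeBound γ = 4 + ⟦ hasCross γ ⟧ + 2 * ⟦ hasArc γ ⟧ + 2 * ⟦ hasArc (γ ᵀ) ⟧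

sizeBoundᵇ : Graph₃ → Bool
sizeBoundᵇ γ = hasPerfect γ ∨ (size γ ≤ᵇ sizeBound γ)

abstract
  -- The predicates involved evaluate γ only at the nine closed pairs, so γ and the
  -- graph₃ of its nine values are interchangeable definitionally.
  sizeBoundᵇ-holds : ∀ γ → sizeBoundᵇ γ ≡ true
  sizeBoundᵇ-holds γ = ∀ᴮ-elim 9 (sizeBoundᵇ ∘ graph₃) refl
    (γ 0F 0F ∷ γ 0F 1F ∷ γ 0F 2F ∷ γ 1F 0F ∷ γ 1F 1F ∷ γ 1F 2F ∷ γ 2F 0F ∷ γ 2F 1F ∷ γ 2F 2F ∷ [])

  size≤ : ∀ γ → hasPerfect γ ≡ false → size γ ≤ sizeBound γ
  size≤ γ h with hasPerfect γ | sizeBoundᵇ-holds γ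
  ... | false | q = ≤ᵇ⇒≤ (size γ) (sizeBound γ) (subst T (sym q) tt)

-- Of the two targets other than r at most one is missed by the partial source. That source takes
-- another, and the full source takes what is left.
Arc-cover : ∀ {δ′ : Graph₃} (α : Arc δ′) r → ∃ λ i → ∃ λ j →
  i ≢ j × r ≡ third i j × δ′ (Arc.full α) i ≡ true × δ′ (Arc.part α) j ≡ true
Arc-cover α r with other r ≟ꟳ Arc.missed α
... | no ≢m  = third r (other r) , other r , dist r , eq r , Arc.full-adj α _ , Arc.part-adj α _ ≢m
  where
  dist : ∀ r → third r (other r) ≢ other r
  dist 0F ()
  dist 1F ()
  dist 2F ()
  eq : ∀ r → r ≡ third (third r (other r)) (other r)
  eq 0F = refl
  eq 1F = refl
  eq 2F = refl
... | yes ≡m = other r , third r (other r) , dist r , eq r , Arc.full-adj α _ ,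
               Arc.part-adj α _ (λ e → dist r (trans ≡m (sym e)))
  where
  dist : ∀ r → other r ≢ third r (other r)
  dist 0F ()
  dist 1F ()
  dist 2F ()
  eq : ∀ r → r ≡ third (other r) (third r (other r))
  eq 0F = refl
  eq 1F = refl
  eq 2F = refl

-- Edges as vertex triples

_≟ₛ_ : DecidableEquality (Subset n)
_≟ₛ_ = ≡-dec Bool._≟_

∈-allSubsets : ∀ (S : Subset n) → S ∈ allSubsets n
∈-allSubsets []          = here refl
∈-allSubsets (false ∷ S) = ∈-++⁺ˡ (∈-map⁺ (false ∷_) (∈-allSubsets S))
∈-allSubsets (true ∷ S)  = ∈-++⁺ʳ (map (false ∷_) (allSubsets _)) (∈-map⁺ (true ∷_) (∈-allSubsets S))

allSubsets-unique : ∀ n → Unique (allSubsets n)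
allSubsets-unique zero    = [] ∷ []
allSubsets-unique (suc n) =
  Unique.++⁺ (Unique.map⁺ ∷-injectiveʳ (allSubsets-unique n))
             (Unique.map⁺ ∷-injectiveʳ (allSubsets-unique n))
             λ (p , q) → clash (∈-map⁻ (false ∷_) p) (∈-map⁻ (true ∷_) q)
  where
  clash : ∀ {S} → ∃ (λ U → U ∈ allSubsets n × S ≡ false ∷ U) →
          ∃ (λ U → U ∈ allSubsets n × S ≡ true ∷ U) → ⊥
  clash (_ , _ , refl) (_ , _ , ())

trio : Fin n → Fin n → Fin n → Subset n
trio x y z = ⁅ x ⁆ ∪ ⁅ y ⁆ ∪ ⁅ z ⁆

∣S∣≡0⇒S≡∅ : ∀ (S : Subset n) → ∣ S ∣ ≡ 0 → S ≡ ∅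
∣S∣≡0⇒S≡∅ []          h = refl
∣S∣≡0⇒S≡∅ (false ∷ S) h = cong (false ∷_) (∣S∣≡0⇒S≡∅ S h)

nonempty : ∀ (S : Subset n) {k} → ∣ S ∣ ≡ suc k → ∃ λ x → x ∈ₛ S
nonempty (true ∷ S)  h = zero , here
nonempty (false ∷ S) h with nonempty S h
... | x , x∈ = suc x , there x∈

extract : ∀ (S : Subset n) {k v} → v ∈ₛ S → ∣ S ∣ ≡ suc k →
          ∃ λ S′ → ∣ S′ ∣ ≡ k × S ≡ ⁅ v ⁆ ∪ S′ × v ∉ₛ S′
extract (true ∷ S) here h =
  false ∷ S , suc-injective h , cong (true ∷_) (sym (∪-identityˡ S)) , λ ()
extract (false ∷ S) (there v∈) h with extract S v∈ h
... | S′ , c , e , v∉ = false ∷ S′ , c , cong (false ∷_) e , λ { (there p) → v∉ p }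
extract {n = suc n} (true ∷ S) {k} (there v∈) h with ∣ S ∣ in eq
... | zero  = contradiction (subst (_ ∈ₛ_) (∣S∣≡0⇒S≡∅ S eq) v∈) ∉⊥
... | suc j with extract S v∈ eq
...   | S′ , c , e , v∉ = true ∷ S′ , trans (cong suc c) (suc-injective h) , cong (true ∷_) e , λ { (there p) → v∉ p }

asTrio : ∀ (S : Subset n) {v} → v ∈ₛ S → ∣ S ∣ ≡ 3 → ∃ λ y → ∃ λ z → y ≢ z × S ≡ trio v y z
asTrio S v∈ h with extract S v∈ h
... | S₁ , h₁ , e₁ , _ with nonempty S₁ h₁
...   | y , y∈ with extract S₁ y∈ h₁
...     | S₂ , h₂ , e₂ , y∉ with nonempty S₂ h₂
...       | z , z∈ with extract S₂ z∈ h₂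
...         | S₃ , h₃ , e₃ , _ =
  y , z , (λ { refl → y∉ z∈ }) ,
  trans e₁ (cong (⁅ _ ⁆ ∪_) (trans e₂ (cong (⁅ y ⁆ ∪_)
    (trans e₃ (trans (cong (⁅ z ⁆ ∪_) (∣S∣≡0⇒S≡∅ S₃ h₃)) (∪-identityʳ ⁅ z ⁆))))))

∣∪∣≤ : ∀ (p q : Subset n) → ∣ p ∪ q ∣ ≤ ∣ p ∣ + ∣ q ∣
∣∪∣≤ []          []          = z≤n
∣∪∣≤ (false ∷ p) (false ∷ q) = ∣∪∣≤ p q
∣∪∣≤ (false ∷ p) (true ∷ q)  = ≤-trans (s≤s (∣∪∣≤ p q)) (≤-reflexive (sym (+-suc ∣ p ∣ ∣ q ∣)))
∣∪∣≤ (true ∷ p)  (false ∷ q) = s≤s (∣∪∣≤ p q)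
∣∪∣≤ (true ∷ p)  (true ∷ q)  = s≤s (≤-trans (∣∪∣≤ p q) (+-monoʳ-≤ ∣ p ∣ (n≤1+n ∣ q ∣)))

trio-swap₁₂ : ∀ (x y z : Fin n) → trio x y z ≡ trio y x z
trio-swap₁₂ x y z = trans (sym (∪-assoc ⁅ x ⁆ ⁅ y ⁆ ⁅ z ⁆))
  (trans (cong (_∪ ⁅ z ⁆) (∪-comm ⁅ x ⁆ ⁅ y ⁆)) (∪-assoc ⁅ y ⁆ ⁅ x ⁆ ⁅ z ⁆))

trio-swap₂₃ : ∀ (x y z : Fin n) → trio x y z ≡ trio x z y
trio-swap₂₃ x y z = cong (⁅ x ⁆ ∪_) (∪-comm ⁅ y ⁆ ⁅ z ⁆)

∣trio-xxz∣≢3 : ∀ (x z : Fin n) → ∣ trio x x z ∣ ≢ 3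
∣trio-xxz∣≢3 x z h = contradiction (≤-trans (≤-reflexive (sym h)) bound) λ { (s≤s (s≤s ())) }
  where
  bound : ∣ trio x x z ∣ ≤ 2
  bound = begin
    ∣ trio x x z ∣                ≡⟨ cong ∣_∣ (sym (∪-assoc ⁅ x ⁆ ⁅ x ⁆ ⁅ z ⁆)) ⟩
    ∣ (⁅ x ⁆ ∪ ⁅ x ⁆) ∪ ⁅ z ⁆ ∣   ≡⟨ cong (λ p → ∣ p ∪ ⁅ z ⁆ ∣) (∪-idem ⁅ x ⁆) ⟩
    ∣ ⁅ x ⁆ ∪ ⁅ z ⁆ ∣             ≤⟨ ∣∪∣≤ ⁅ x ⁆ ⁅ z ⁆ ⟩
    ∣ ⁅ x ⁆ ∣ + ∣ ⁅ z ⁆ ∣         ≡⟨ cong₂ _+_ (∣⁅x⁆∣≡1 x) (∣⁅x⁆∣≡1 z) ⟩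
    2                             ∎
    where open ≤-Reasoning

module _ (H : Hypergraph3 n) where

  private V = allFin n

  E : Fin n → Fin n → Fin n → Bool
  E x y z = edge H (trio x y z)

  E-swap₁₂ : ∀ x y z → E x y z ≡ E y x z
  E-swap₁₂ x y z = cong (edge H) (trio-swap₁₂ x y z)

  E-swap₂₃ : ∀ x y z → E x y z ≡ E x z y
  E-swap₂₃ x y z = cong (edge H) (trio-swap₂₃ x y z)

  E⇒≢₁₂ : ∀ {x y z} → E x y z ≡ true → x ≢ y
  E⇒≢₁₂ {x} {_} {z} h refl = ∣trio-xxz∣≢3 x z (uniform H _ h)

  E⇒≢₂₃ : ∀ {x y z} → E x y z ≡ true → y ≢ z
  E⇒≢₂₃ {x} {y} {z} h refl = E⇒≢₁₂ {y} {y} {x}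
    (trans (E-swap₂₃ y y x) (trans (E-swap₁₂ y x y) h)) refl

  E⇒≢₁₃ : ∀ {x y z} → E x y z ≡ true → x ≢ z
  E⇒≢₁₃ {x} {y} {z} h = E⇒≢₁₂ (trans (sym (E-swap₂₃ x y z)) h)

  ∑-allSubsets-δ : ∀ T → ∑ (allSubsets n) (λ S → δ _≟ₛ_ S T * ⟦ edge H S ⟧) ≡ ⟦ edge H T ⟧
  ∑-allSubsets-δ T = ∑-δ _≟ₛ_ (allSubsets-unique n) (∈-allSubsets T) (λ S → ⟦ edge H S ⟧)

  length-filter-edges : ∀ p → length (filterᵇ p (edges H)) ≡ ∑ (allSubsets n) (λ S → ⟦ edge H S ⟧ * ⟦ p S ⟧)
  length-filter-edges p = begin
    length (filterᵇ p (edges H))                          ≡⟨ length≡∑ (filterᵇ p (edges H)) ⟩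
    ∑ (filterᵇ p (edges H)) (λ _ → 1)                     ≡⟨ ∑-filterᵇ p (edges H) (λ _ → 1) ⟩
    ∑ (edges H) (λ S → ⟦ p S ⟧ * 1)                       ≡⟨ ∑-cong (edges H) (λ S → *-identityʳ ⟦ p S ⟧) ⟩
    ∑ (edges H) (λ S → ⟦ p S ⟧)                           ≡⟨ ∑-filterᵇ (edge H) (allSubsets n) (λ S → ⟦ p S ⟧) ⟩
    ∑ (allSubsets n) (λ S → ⟦ edge H S ⟧ * ⟦ p S ⟧)       ∎
    where open ≡-Reasoning

  orderedDeg : Fin n → ℕ
  orderedDeg v = ∑ V λ y → ∑ V λ z → ⟦ E v y z ⟧

  -- An edge v y z is found at (y , z) and again at (z , y). Degrees are only ever bounded from
  -- below, so one direction suffices.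
  2*deg≤orderedDeg : ∀ v → 2 * deg H v ≤ orderedDeg v
  2*deg≤orderedDeg v = begin
    2 * deg H v
      ≡⟨ cong (2 *_) (length-filter-edges (λ S → does (v ∈? S))) ⟩
    2 * ∑ (allSubsets n) (λ S → ⟦ edge H S ⟧ * ⟦ does (v ∈? S) ⟧)
      ≡⟨ sym (∑-*ˡ (allSubsets n) 2 _) ⟩
    ∑ (allSubsets n) (λ S → 2 * (⟦ edge H S ⟧ * ⟦ does (v ∈? S) ⟧))
      ≤⟨ ∑-mono (allSubsets n) pointwise ⟩
    ∑ (allSubsets n) (λ S → ∑ V λ y → ∑ V λ z → t S y z)
      ≡⟨ ∑-swap (allSubsets n) V _ ⟩
    ∑ V (λ y → ∑ (allSubsets n) λ S → ∑ V λ z → t S y z)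
      ≡⟨ ∑-cong V (λ y → ∑-swap (allSubsets n) V _) ⟩
    ∑ V (λ y → ∑ V λ z → ∑ (allSubsets n) λ S → t S y z)
      ≡⟨ ∑-cong V (λ y → ∑-cong V λ z → ∑-allSubsets-δ (trio v y z)) ⟩
    orderedDeg v ∎
    where
    open ≤-Reasoning
    t : Subset n → Fin n → Fin n → ℕ
    t S y z = δ _≟ₛ_ S (trio v y z) * ⟦ edge H S ⟧

    t≡1 : ∀ {S y z} → S ≡ trio v y z → edge H S ≡ true → t S y z ≡ 1
    t≡1 {S} refl e = cong₂ _*_ (δ-refl _≟ₛ_ S) (cong ⟦_⟧ e)

    pointwise : ∀ S → 2 * (⟦ edge H S ⟧ * ⟦ does (v ∈? S) ⟧) ≤ ∑ V (λ y → ∑ V λ z → t S y z)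
    pointwise S with edge H S in e | v ∈? S
    ... | false | _      = z≤n
    ... | true  | no _   = z≤n
    ... | true  | yes v∈ with asTrio S v∈ (uniform H S e)
    ...   | y , z , y≢z , eq = begin
      1 + 1                                      ≡⟨ cong₂ _+_ (sym (t≡1 eq e)) (sym (t≡1 (trans eq (trio-swap₂₃ v y z)) e)) ⟩
      t S y z + t S z y                          ≤⟨ +-mono-≤ (∈⇒≤∑ (t S y) (∈-allFin z)) (∈⇒≤∑ (t S z) (∈-allFin y)) ⟩
      ∑ V (t S y) + ∑ V (t S z)                  ≤⟨ ∈∈⇒+≤∑ (λ y → ∑ V (t S y)) (∈-allFin y) (∈-allFin z) y≢z ⟩
      ∑ V (λ y → ∑ V (t S y))                    ≡⟨ cong (λ b → ∑ V (λ y → ∑ V λ z → δ _≟ₛ_ S (trio v y z) * ⟦ b ⟧)) e ⟩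
      ∑ V (λ y → ∑ V λ z → δ _≟ₛ_ S (trio v y z) * 1) ∎

  -- One of the six orders of each edge is enough; the overcount disappears in the constants.
  inducedEdges≤ : ∀ (B : Subset n) bs → (∀ x → x ∈ₛ B → x ∈ bs) →
    inducedEdges H B ≤ ∑ bs (λ x → ∑ bs λ y → ∑ bs λ z → ⟦ E x y z ⟧)
  inducedEdges≤ B bs B⊆bs = begin
    inducedEdges H B
      ≡⟨ length-filter-edges (λ S → does (S ⊆? B)) ⟩
    ∑ (allSubsets n) (λ S → ⟦ edge H S ⟧ * ⟦ does (S ⊆? B) ⟧)
      ≤⟨ ∑-mono (allSubsets n) pointwise ⟩
    ∑ (allSubsets n) (λ S → ∑ bs λ x → ∑ bs λ y → ∑ bs λ z → t S x y z)
      ≡⟨ ∑-swap (allSubsets n) bs _ ⟩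
    ∑ bs (λ x → ∑ (allSubsets n) λ S → ∑ bs λ y → ∑ bs λ z → t S x y z)
      ≡⟨ ∑-cong bs (λ x → ∑-swap (allSubsets n) bs _) ⟩
    ∑ bs (λ x → ∑ bs λ y → ∑ (allSubsets n) λ S → ∑ bs λ z → t S x y z)
      ≡⟨ ∑-cong bs (λ x → ∑-cong bs λ y → ∑-swap (allSubsets n) bs _) ⟩
    ∑ bs (λ x → ∑ bs λ y → ∑ bs λ z → ∑ (allSubsets n) λ S → t S x y z)
      ≡⟨ ∑-cong bs (λ x → ∑-cong bs λ y → ∑-cong bs λ z → ∑-allSubsets-δ (trio x y z)) ⟩
    ∑ bs (λ x → ∑ bs λ y → ∑ bs λ z → ⟦ E x y z ⟧) ∎
    where
    open ≤-Reasoning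
    t : Subset n → Fin n → Fin n → Fin n → ℕ
    t S x y z = δ _≟ₛ_ S (trio x y z) * ⟦ edge H S ⟧

    pointwise : ∀ S → ⟦ edge H S ⟧ * ⟦ does (S ⊆? B) ⟧ ≤ ∑ bs (λ x → ∑ bs λ y → ∑ bs λ z → t S x y z)
    pointwise S with edge H S in e | S ⊆? B
    ... | false | _      = z≤n
    ... | true  | no _   = z≤n
    ... | true  | yes S⊆B with nonempty S (uniform H S e)
    ...   | x , x∈ with asTrio S x∈ (uniform H S e)
    ...     | y , z , y≢z , refl = begin
      1
        ≡⟨ cong (_* 1) (sym (δ-refl _≟ₛ_ S)) ⟩
      δ _≟ₛ_ S (trio x y z) * 1
        ≤⟨ ∈⇒≤∑ (λ z → δ _≟ₛ_ S (trio x y z) * 1) (B⊆bs z (S⊆B (x∈p∪q⁺ {p = ⁅ x ⁆} (inj₂ (x∈p∪q⁺ {p = ⁅ y ⁆} (inj₂ (x∈⁅x⁆ z))))))) ⟩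
      ∑ bs (λ z → δ _≟ₛ_ S (trio x y z) * 1)
        ≤⟨ ∈⇒≤∑ (λ y → ∑ bs λ z → δ _≟ₛ_ S (trio x y z) * 1) (B⊆bs y (S⊆B (x∈p∪q⁺ {p = ⁅ x ⁆} (inj₂ (x∈p∪q⁺ {p = ⁅ y ⁆} (inj₁ (x∈⁅x⁆ y))))))) ⟩
      ∑ bs (λ y → ∑ bs λ z → δ _≟ₛ_ S (trio x y z) * 1)
        ≤⟨ ∈⇒≤∑ (λ x → ∑ bs λ y → ∑ bs λ z → δ _≟ₛ_ S (trio x y z) * 1) (B⊆bs x (S⊆B x∈)) ⟩
      ∑ bs (λ x → ∑ bs λ y → ∑ bs λ z → δ _≟ₛ_ S (trio x y z) * 1) ∎

-- Matchings and augmentation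

∑≤1 : ∀ {A : Set} {f : A → ℕ} {xs} → (∀ x → f x ≤ 1) →
      AllPairs (λ x y → f x ≡ 0 ⊎ f y ≡ 0) xs → ∑ xs f ≤ 1
∑≤1 h [] = z≤n
∑≤1 {f = f} {x ∷ xs} h (px ∷ p) with f x | h x
... | zero | _ = ∑≤1 h p
... | suc zero | _ = ≤-reflexive (cong suc (∑-zero xs vanish))
  where
  vanish : ∀ y → y ∈ xs → f y ≡ 0
  vanish y y∈ with All.lookup px y∈
  ... | inj₁ ()
  ... | inj₂ fy≡0 = fy≡0
... | suc (suc _) | s≤s ()

filterᵇ-∈ : ∀ {A : Set} (p : A → Bool) {x} xs → x ∈ filterᵇ p xs → x ∈ xs × p x ≡ true
filterᵇ-∈ p (y ∷ ys) h with p y in eq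
filterᵇ-∈ p (y ∷ ys) (here refl) | true = here refl , eq
filterᵇ-∈ p (y ∷ ys) (there h)   | true = let a , b = filterᵇ-∈ p ys h in there a , b
filterᵇ-∈ p (y ∷ ys) h           | false = let a , b = filterᵇ-∈ p ys h in there a , b

filterᵇ-AllPairs : ∀ {A : Set} {R : A → A → Set} (p : A → Bool) {xs} →
                   AllPairs R xs → AllPairs R (filterᵇ p xs)
filterᵇ-AllPairs p = AllPairs.filter⁺ (T? ∘ p)

AllPairs-lookup : ∀ {A : Set} {R : A → A → Set} {xs} → (∀ {x y} → R x y → R y x) →
                  AllPairs R xs → ∀ {x y} → x ∈ xs → y ∈ xs → x ≢ y → R x y
AllPairs-lookup s (p ∷ ps) (here refl) (here refl) x≢y = contradiction refl x≢y
AllPairs-lookup s (p ∷ ps) (here refl) (there y∈)  x≢y = All.lookup p y∈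
AllPairs-lookup s (p ∷ ps) (there x∈)  (here refl) x≢y = s (All.lookup p x∈)
AllPairs-lookup s (p ∷ ps) (there x∈)  (there y∈)  x≢y = AllPairs-lookup s ps x∈ y∈ x≢y

-- Edges of a matching are ordered, so that their vertices can be addressed by `Fin 3`; `toSubset`
-- forgets the order at the end.
Triple : ℕ → Set
Triple n = Vec (Fin n) 3

at : Triple n → Fin 3 → Fin n
at = lookup

_≟₃_ : DecidableEquality (Triple n)
_≟₃_ = ≡-dec _≟ꟳ_

VertexDisjoint : Triple n → Triple n → Set
VertexDisjoint s t = ∀ i j → at s i ≢ at t j

VertexDisjoint-sym : ∀ {s t : Triple n} → VertexDisjoint s t → VertexDisjoint t s
VertexDisjoint-sym d i j e = d j i (sym e)

anyTriple? : ∀ {P : Triple n → Set} → Decidable P → Dec (∃ P)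
anyTriple? P? = map′
  (λ (x , y , z , p) → (x ∷ y ∷ z ∷ []) , p)
  (λ { ((x ∷ y ∷ z ∷ []) , p) → x , y , z , p })
  (any? λ x → any? λ y → any? λ z → P? (x ∷ y ∷ z ∷ []))

anyList? : ∀ {P : List (Triple n) → Set} → Decidable P → ∀ k → Dec (∃ λ M → length M ≡ k × P M)
anyList? P? zero = map′ (λ p → [] , refl , p) (λ { ([] , _ , p) → p }) (P? [])
anyList? P? (suc k) = map′
  (λ (t , M , l , p) → t ∷ M , cong suc l , p)
  (λ { (t ∷ M , l , p) → t , M , suc-injective l , p })
  (anyTriple? λ t → anyList? (λ M → P? (t ∷ M)) k)

last-true : ∀ {P : ℕ → Set} → Decidable P → P 0 → ∀ N → ¬ P N → ∃ λ k → P k × ¬ P (suc k)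
last-true P? p0 zero    ¬p = contradiction p0 ¬p
last-true P? p0 (suc N) ¬p with P? N
... | yes p = N , p , ¬p
... | no ¬q = last-true P? p0 N ¬q

coverage : List (Triple n) → Fin n → ℕ
coverage M v = ∑ M λ e → ∑ (allFin 3) λ i → δ _≟ꟳ_ v (at e i)

leftover : List (Triple n) → List (Fin n)
leftover M = filterᵇ (λ v → coverage M v ≡ᵇ 0) (allFin _)

module _ (H : Hypergraph3 n) where

  private V = allFin n

  isEdge : Triple n → Bool
  isEdge t = E H (at t 0F) (at t 1F) (at t 2F)

  record Matching (M : List (Triple n)) : Set where
    constructor matching
    field
      areEdges     : All (λ t → isEdge t ≡ true) M
      areDisjoint  : AllPairs VertexDisjoint M

  open Matching public

  matching? : Decidable Matching
  matching? M = map′ (λ (a , b) → matching a b) (λ m → areEdges m , areDisjoint m)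
    (All.all? (λ t → isEdge t Bool.≟ true) M ×-dec
     AllPairs.allPairs? (λ s t → all? λ i → all? λ j → ¬? (at s i ≟ꟳ at t j)) M)

  isEdge⇒injective : ∀ t → isEdge t ≡ true → ∀ i j → at t i ≡ at t j → i ≡ j
  isEdge⇒injective t h 0F 0F e = refl
  isEdge⇒injective t h 0F 1F e = contradiction e (E⇒≢₁₂ H h)
  isEdge⇒injective t h 0F 2F e = contradiction e (E⇒≢₁₃ H h)
  isEdge⇒injective t h 1F 0F e = contradiction (sym e) (E⇒≢₁₂ H h)
  isEdge⇒injective t h 1F 1F e = refl
  isEdge⇒injective t h 1F 2F e = contradiction e (E⇒≢₂₃ H h)
  isEdge⇒injective t h 2F 0F e = contradiction (sym e) (E⇒≢₁₃ H h)
  isEdge⇒injective t h 2F 1F e = contradiction (sym e) (E⇒≢₂₃ H h)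
  isEdge⇒injective t h 2F 2F e = refl

  module MatchingProperties {M : List (Triple n)} (mat : Matching M) where

    isEdge-∈ : ∀ {e} → e ∈ M → isEdge e ≡ true
    isEdge-∈ = All.lookup (areEdges mat)

    at-injective : ∀ {e f i j} → e ∈ M → f ∈ M → at e i ≡ at f j → e ≡ f × i ≡ j
    at-injective {e} {f} {i} {j} e∈ f∈ eq with e ≟₃ f
    ... | yes refl = refl , isEdge⇒injective e (isEdge-∈ e∈) i j eq
    ... | no e≢f   = contradiction eq
      (AllPairs-lookup (λ {s} {t} → VertexDisjoint-sym {s = s} {t}) (areDisjoint mat) e∈ f∈ e≢f i j)

    unique : Unique M
    unique = AllPairs.map (λ {s} d → λ { refl → d 0F 0F refl }) (areDisjoint mat)

    private
      δ-zero : ∀ {v x y : Fin n} → x ≢ y → δ _≟ꟳ_ v x ≡ 0 ⊎ δ _≟ꟳ_ v y ≡ 0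
      δ-zero {v} {x} {y} x≢y with v ≟ꟳ x
      ... | no _     = inj₁ refl
      ... | yes refl = inj₂ (δ-≢ _≟ꟳ_ x≢y)

      edgeCoverage : Fin n → Triple n → ℕ
      edgeCoverage v e = ∑ (allFin 3) λ i → δ _≟ꟳ_ v (at e i)

      edgeCoverage-zero : ∀ {v s t} → VertexDisjoint s t → edgeCoverage v s ≡ 0 ⊎ edgeCoverage v t ≡ 0
      edgeCoverage-zero {v} {s} {t} d with any? (λ i → v ≟ꟳ at s i)
      ... | no ¬p        = inj₁ (∑-zero (allFin 3) λ i _ → δ-≢ _≟ꟳ_ (λ e → ¬p (i , e)))
      ... | yes (i , eq) = inj₂ (∑-zero (allFin 3) λ j _ → δ-≢ _≟ꟳ_ (λ e → d i j (trans (sym eq) e)))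

      coverage≤1-aux : ∀ v xs → All (λ t → isEdge t ≡ true) xs → AllPairs VertexDisjoint xs → coverage xs v ≤ 1
      coverage≤1-aux v [] _ _ = z≤n
      coverage≤1-aux v (e ∷ xs) (h ∷ hs) (d ∷ ds) with edgeCoverage v e in eq | one
        where
        one : edgeCoverage v e ≤ 1
        one = ∑≤1 {f = λ i → δ _≟ꟳ_ v (at e i)} (λ i → ⟦⟧≤1 _) (AllPairs.map (λ {i} {j} i≢j → δ-zero {v} {at e i} {at e j} (λ e′ → i≢j (isEdge⇒injective e h i j e′))) (Unique.allFin⁺ 3))
      ... | zero | _ = coverage≤1-aux v xs hs ds
      ... | suc (suc _) | s≤s ()
      ... | suc zero | _ = ≤-reflexive (cong suc (∑-zero xs vanish))
        where
        vanish : ∀ f → f ∈ xs → edgeCoverage v f ≡ 0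
        vanish f f∈ with edgeCoverage-zero {v} {e} {f} (All.lookup d f∈)
        ... | inj₁ z with () ← trans (sym eq) z
        ... | inj₂ z = z

    coverage≤1 : ∀ v → coverage M v ≤ 1
    coverage≤1 v = coverage≤1-aux v M (areEdges mat) (areDisjoint mat)

    -- Coverage is 0 or 1, so it is itself the indicator of the covered vertices, and exchanging the
    -- sums turns it into a sum over the positions of `M`.
    ∑-partition : ∀ (f : Fin n → ℕ) →
      ∑ V f ≡ ∑ (leftover M) f + ∑ M (λ e → ∑ (allFin 3) λ i → f (at e i))
    ∑-partition f = begin
      ∑ V f
        ≡⟨ ∑-cong V split ⟩
      ∑ V (λ v → ⟦ coverage M v ≡ᵇ 0 ⟧ * f v + coverage M v * f v)
        ≡⟨ ∑-+ V _ _ ⟩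
      ∑ V (λ v → ⟦ coverage M v ≡ᵇ 0 ⟧ * f v) + ∑ V (λ v → coverage M v * f v)
        ≡⟨ cong₂ _+_ (sym (∑-filterᵇ _ V f)) covered ⟩
      ∑ (leftover M) f + ∑ M (λ e → ∑ (allFin 3) λ i → f (at e i)) ∎
      where
      open ≡-Reasoning
      split : ∀ v → f v ≡ ⟦ coverage M v ≡ᵇ 0 ⟧ * f v + coverage M v * f v
      split v with coverage M v | coverage≤1 v
      ... | zero        | _ = sym (trans (+-identityʳ _) (+-identityʳ (f v)))
      ... | suc zero    | _ = sym (+-identityʳ (f v))
      ... | suc (suc _) | s≤s ()
      covered : ∑ V (λ v → coverage M v * f v) ≡ ∑ M (λ e → ∑ (allFin 3) λ i → f (at e i))
      covered = begin
        ∑ V (λ v → coverage M v * f v)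
          ≡⟨ ∑-cong V (λ v → sym (∑-*ʳ M (f v) _)) ⟩
        ∑ V (λ v → ∑ M λ e → edgeCoverage v e * f v)
          ≡⟨ ∑-swap V M _ ⟩
        ∑ M (λ e → ∑ V λ v → edgeCoverage v e * f v)
          ≡⟨ ∑-cong M (λ e → ∑-cong V λ v → sym (∑-*ʳ (allFin 3) (f v) (λ i → δ _≟ꟳ_ v (at e i)))) ⟩
        ∑ M (λ e → ∑ V λ v → ∑ (allFin 3) λ i → δ _≟ꟳ_ v (at e i) * f v)
          ≡⟨ ∑-cong M (λ e → ∑-swap V (allFin 3) (λ v i → δ _≟ꟳ_ v (at e i) * f v)) ⟩
        ∑ M (λ e → ∑ (allFin 3) λ i → ∑ V λ v → δ _≟ꟳ_ v (at e i) * f v)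
          ≡⟨ ∑-cong M (λ e → ∑-cong (allFin 3) λ i → ∑-δ _≟ꟳ_ (Unique.allFin⁺ n) (∈-allFin (at e i)) f) ⟩
        ∑ M (λ e → ∑ (allFin 3) λ i → f (at e i)) ∎

    order : n ≡ length (leftover M) + 3 * length M
    order = begin
      n                 ≡⟨ sym (length-tabulate (λ i → i)) ⟩
      length V          ≡⟨ length≡∑ V ⟩
      ∑ V (λ _ → 1)     ≡⟨ ∑-partition (λ _ → 1) ⟩
      ∑ (leftover M) (λ _ → 1) + ∑ M (λ _ → 3)
                        ≡⟨ cong₂ _+_ (sym (length≡∑ (leftover M))) (trans (∑-const M 3) (*-comm (length M) 3)) ⟩
      length (leftover M) + 3 * length M ∎
      where open ≡-Reasoning

    leftover-≢ : ∀ {v e i} → v ∈ leftover M → e ∈ M → v ≢ at e i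
    leftover-≢ {v} {e} {i} v∈ e∈ refl = absurd (coverage M v) pos (proj₂ (filterᵇ-∈ _ V v∈))
      where
      pos : 1 ≤ coverage M v
      pos = ≤-trans (≤-reflexive (sym (δ-refl _≟ꟳ_ v)))
              (≤-trans (∈⇒≤∑ (λ i → δ _≟ꟳ_ v (at e i)) (∈-allFin i)) (∈⇒≤∑ (edgeCoverage v) e∈))
      absurd : ∀ c → 1 ≤ c → (c ≡ᵇ 0) ≡ true → ⊥
      absurd (suc c) _ ()

    leftover-unique : Unique (leftover M)
    leftover-unique = filterᵇ-AllPairs _ (Unique.allFin⁺ n)

  Maximum : List (Triple n) → Set
  Maximum M = ∀ M′ → Matching M′ → length M′ ≤ length M

  -- `last-true` yields only some attained length k with k + 1 not attained. This k is the maximum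
  -- because prefixes of matchings are matchings. All properties searched for are decidable, so the
  -- maximum is obtained constructively.
  maximum-matching : ∃ λ M → Matching M × Maximum M
  maximum-matching = finish (last-true (anyList? matching?) ([] , refl , matching [] []) (suc n) tooLong)
    where
    tooLong : ¬ ∃ λ M → length M ≡ suc n × Matching M
    tooLong (M , l , m) = <-irrefl refl (begin-strict
      n                                    <⟨ n<1+n n ⟩
      suc n                                ≡⟨ sym l ⟩
      length M                             ≤⟨ m≤m+n (length M) _ ⟩
      3 * length M                         ≤⟨ m≤n+m _ (length (leftover M)) ⟩
      length (leftover M) + 3 * length M   ≡⟨ sym (MatchingProperties.order m) ⟩
      n                                    ∎)
      where open ≤-Reasoning
    finish : (∃ λ k → (∃ λ M → length M ≡ k × Matching M) × ¬ (∃ λ M → length M ≡ suc k × Matching M)) →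
             ∃ λ M → Matching M × Maximum M
    finish (k , (M , l , m) , ¬p) = M , m , λ M′ m′ → ≮⇒≥ λ lt → ¬p
      ( take (suc k) M′
      , trans (length-take (suc k) M′) (m≤n⇒m⊓n≡m (subst (_< length M′) l lt))
      , matching (All.take⁺ (suc k) (areEdges m′)) (AllPairs.take⁺ (suc k) (areDisjoint m′)) )

  module Augmentation {M : List (Triple n)} (mat : Matching M) (max : Maximum M) where

    open MatchingProperties mat public
    open import Data.List.Membership.DecPropositional (_≟₃_ {n}) using () renaming (_∈?_ to _∈₃?_)

    private
      L = leftover M

    keep : List (Triple n) → List (Triple n)
    keep R = filterᵇ (λ t → not (does (t ∈₃? R))) M

    length-keep : ∀ R → length M ≤ length (keep R) + length R
    length-keep R = begin
      length M
        ≡⟨ length≡∑ M ⟩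
      ∑ M (λ _ → 1)
        ≤⟨ ∑-mono M pointwise ⟩
      ∑ M (λ t → ⟦ not (does (t ∈₃? R)) ⟧ * 1 + ∑ R (λ r → δ _≟₃_ t r))
        ≡⟨ ∑-+ M _ _ ⟩
      ∑ M (λ t → ⟦ not (does (t ∈₃? R)) ⟧ * 1) + ∑ M (λ t → ∑ R (λ r → δ _≟₃_ t r))
        ≡⟨ cong₂ _+_ (trans (sym (∑-filterᵇ _ M (λ _ → 1))) (sym (length≡∑ (keep R)))) (∑-swap M R _) ⟩
      length (keep R) + ∑ R (λ r → ∑ M λ t → δ _≟₃_ t r)
        ≤⟨ +-monoʳ-≤ (length (keep R)) (∑-bound R (λ r _ → ∑-δ≤1 _≟₃_ unique r)) ⟩
      length (keep R) + length R * 1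
        ≡⟨ cong (length (keep R) +_) (*-identityʳ (length R)) ⟩
      length (keep R) + length R ∎
      where
      open ≤-Reasoning
      pointwise : ∀ t → 1 ≤ ⟦ not (does (t ∈₃? R)) ⟧ * 1 + ∑ R (λ r → δ _≟₃_ t r)
      pointwise t with t ∈₃? R
      ... | no _   = s≤s z≤n
      ... | yes t∈ = ≤-trans (≤-reflexive (sym (δ-refl _≟₃_ t))) (∈⇒≤∑ (δ _≟₃_ t) t∈)

    ∈-keep : ∀ {R t} → t ∈ keep R → t ∈ M × t ∉ R
    ∈-keep {R} {t} h with filterᵇ-∈ _ M h
    ... | t∈M , e with t ∈₃? R
    ...   | no t∉ = t∈M , t∉

    -- The exchange of `R` for `A`: vertices of `A` lie on `R` or are uncovered, hence avoid every
    -- kept edge, and the result would be longer than `M`.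
    no-augmentation : ∀ R A → (∀ {r} → r ∈ R → r ∈ M) → Matching A →
      (∀ {a} → a ∈ A → ∀ i → (∃ λ r → r ∈ R × ∃ λ j → at a i ≡ at r j) ⊎ at a i ∈ L) →
      length A ≢ suc (length R)
    no-augmentation R A R⊆M matA where-A len = <-irrefl refl (begin-strict
      length M                        ≤⟨ length-keep R ⟩
      length (keep R) + length R      ≡⟨ +-comm (length (keep R)) (length R) ⟩
      length R + length (keep R)      <⟨ n<1+n _ ⟩
      suc (length R) + length (keep R) ≡⟨ cong (_+ length (keep R)) (sym len) ⟩
      length A + length (keep R)      ≡⟨ sym (length-++ A) ⟩
      length (A ++ keep R)            ≤⟨ max (A ++ keep R) new ⟩
      length M                        ∎)
      where
      open ≤-Reasoning
      apart : ∀ {a q} → a ∈ A → q ∈ keep R → VertexDisjoint a q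
      apart {a} a∈ q∈ i j eq with ∈-keep {R} q∈ | where-A a∈ i
      ... | q∈M , q∉R | inj₂ l = leftover-≢ l q∈M eq
      ... | q∈M , q∉R | inj₁ (r , r∈ , k , eq′)
          with at-injective (R⊆M r∈) q∈M (trans (sym eq′) eq)
      ...   | refl , _ = q∉R r∈
      new : Matching (A ++ keep R)
      new = matching
        (All.++⁺ (areEdges matA) (All.tabulate λ t∈ → isEdge-∈ (proj₁ (∈-keep {R} t∈))))
        (AllPairs.++⁺ (areDisjoint matA) (filterᵇ-AllPairs _ (areDisjoint mat))
          (All.tabulate λ a∈ → All.tabulate λ q∈ → apart a∈ q∈))

-- The link graph of the uncovered vertices

lookup-injective : ∀ {A B : Set} (f : A → B) {xs} → Unique (map f xs) →
  ∀ i j → f (List.lookup xs i) ≡ f (List.lookup xs j) → i ≡ j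
lookup-injective f {x ∷ xs} (p ∷ u) zero    zero    e = refl
lookup-injective f {x ∷ xs} (p ∷ u) zero    (suc j) e =
  contradiction e (All.lookup p (∈-map⁺ f (∈-lookup {xs = xs} j)))
lookup-injective f {x ∷ xs} (p ∷ u) (suc i) zero    e =
  contradiction (sym e) (All.lookup p (∈-map⁺ f (∈-lookup {xs = xs} i)))
lookup-injective f {x ∷ xs} (p ∷ u) (suc i) (suc j) e = cong suc (lookup-injective f u i j e)

module Links {n : ℕ} (H : Hypergraph3 n) {M : List (Triple n)}
             (mat : Matching H M) (max : Maximum H M) where

  open Augmentation H mat max public
  open import Data.List.Membership.DecPropositional (_≟ꟳ_ {n}) using () renaming (_∈?_ to _∈ᵥ?_)

  L : List (Fin n)
  L = leftover M

  codegree : Fin n → Fin n → ℕ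
  codegree x y = ∑ L λ v → ⟦ E H v x y ⟧

  -- Six is the largest number of pairs that one augmentation has to extend by distinct
  -- vertices of L.
  Γ : Fin n → Fin n → Bool
  Γ x y = 6 ≤ᵇ codegree x y

  Γ-sym : ∀ x y → Γ x y ≡ Γ y x
  Γ-sym x y = cong (6 ≤ᵇ_) (∑-cong L λ v → cong ⟦_⟧ (E-swap₂₃ H v x y))

  Γ⇒fresh : ∀ {x y} → Γ x y ≡ true → ∀ U → length U < 6 → ∃ λ v → v ∈ L × E H v x y ≡ true × v ∉ U
  Γ⇒fresh {x} {y} h U l = extract-vertex (∑-pos⇒∃ L good (+-cancelʳ-< (length U) 0 (∑ L good) (begin-strict
      length U                                    <⟨ l ⟩
      6                                           ≤⟨ ≤ᵇ⇒≤ 6 (codegree x y) (subst T (sym h) tt) ⟩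
      codegree x y                                ≤⟨ ∑-mono L pointwise ⟩
      ∑ L (λ v → good v + ∑ U (λ u → δ _≟ꟳ_ v u)) ≡⟨ ∑-+ L _ _ ⟩
      ∑ L good + ∑ L (λ v → ∑ U λ u → δ _≟ꟳ_ v u) ≡⟨ cong (∑ L good +_) (∑-swap L U _) ⟩
      ∑ L good + ∑ U (λ u → ∑ L λ v → δ _≟ꟳ_ v u) ≤⟨ +-monoʳ-≤ (∑ L good) (∑-bound U (λ u _ → ∑-δ≤1 _≟ꟳ_ leftover-unique u)) ⟩
      ∑ L good + length U * 1                     ≡⟨ cong (∑ L good +_) (*-identityʳ (length U)) ⟩
      ∑ L good + length U                         ∎)))
    where
    open ≤-Reasoning
    good : Fin n → ℕ
    good v = ⟦ E H v x y ∧ not (does (v ∈ᵥ? U)) ⟧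
    pointwise : ∀ v → ⟦ E H v x y ⟧ ≤ good v + ∑ U (λ u → δ _≟ꟳ_ v u)
    pointwise v with E H v x y | v ∈ᵥ? U
    ... | false | _      = z≤n
    ... | true  | no _   = s≤s z≤n
    ... | true  | yes v∈ = ≤-trans (≤-reflexive (sym (δ-refl _≟ꟳ_ v))) (∈⇒≤∑ (δ _≟ꟳ_ v) v∈)
    extract-vertex : (∃ λ v → v ∈ L × 0 < good v) → ∃ λ v → v ∈ L × E H v x y ≡ true × v ∉ U
    extract-vertex (v , v∈ , p) with E H v x y in e | v ∈ᵥ? U
    ... | true | no v∉ = v , v∈ , e , v∉

  γ : Triple n → Triple n → Graph₃
  γ e f i j = Γ (at e i) (at f j)

  -- The renaming puts the vertices that matter at fixed indices. An augmentation can then be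
  -- written with numerals only, and the freshness of each vertex is decided by evaluating `∉?` on
  -- closed lists of positions; `point-injective` carries this over to vertices.
  record LabelledEdge : Set where
    constructor labelled
    field
      triple    : Triple n
      triple∈M  : triple ∈ M
      relabel   : Fin 3 → Fin 3
      relabel-injective : InjectiveOn₃ relabel

  open LabelledEdge

  module Configuration (R : List LabelledEdge) (R-unique : Unique (map triple R)) where

    Position : Set
    Position = Fin (length R) × Fin 3

    _≟ₚ_ : DecidableEquality Position
    _≟ₚ_ = Product.≡-dec _≟ꟳ_ _≟ꟳ_

    open import Data.List.Membership.DecPropositional _≟ₚ_ using (_∉?_)

    point : Position → Fin n
    point (r , i) = at (triple (List.lookup R r)) (relabel (List.lookup R r) i)

    point-injective : ∀ {p q} → point p ≡ point q → p ≡ q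
    point-injective {r , i} {s , j} e
      with at-injective (triple∈M (List.lookup R r)) (triple∈M (List.lookup R s)) e
    ... | e₁ , e₂ with lookup-injective triple R-unique r s e₁
    ...   | refl = cong (r ,_) (relabel-injective (List.lookup R r) i j e₂)

    point≢leftover : ∀ p {v} → v ∈ L → v ≢ point p
    point≢leftover (r , i) v∈ = leftover-≢ v∈ (triple∈M (List.lookup R r))

    -- A partial augmentation with used positions `W`, u used vertices of `L` and c new edges. The
    -- counts are indices so that the bound of six and the final length are also settled by
    -- evaluation.
    record State (W : List Position) (u c : ℕ) : Set where
      field
        U       : List (Fin n)
        U-size  : length U ≡ u
        U⊆L     : ∀ {v} → v ∈ U → v ∈ L
        new     : List (Triple n)
        size-new : length new ≡ c
        new-matching : Matching H new
        located : ∀ {a} → a ∈ new → ∀ i → (∃ λ p → p ∈ W × at a i ≡ point p) ⊎ at a i ∈ U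

    open State

    avoids : ∀ {W u c} (s : State W u c) {x} → x ∉ W → ∀ {a} → a ∈ new s → ∀ j → point x ≢ at a j
    avoids {W} s x∉ a∈ j e with located s a∈ j
    ... | inj₁ (y , y∈ , e′) = x∉ (subst (_∈ W) (sym (point-injective (trans e e′))) y∈)
    ... | inj₂ l             = point≢leftover _ (U⊆L s l) (sym e)

    start : State [] 0 0
    start = record
      { U = [] ; U-size = refl ; U⊆L = λ () ; new = [] ; size-new = refl
      ; new-matching = matching [] [] ; located = λ () }

    add-edge : ∀ {W u c} p q r {_ : True (p ∉? W)} {_ : True (q ∉? W)} {_ : True (r ∉? W)} →
               E H (point p) (point q) (point r) ≡ true → State W u c →
               State (p ∷ q ∷ r ∷ W) u (suc c)
    add-edge {W} p q r {p∉} {q∉} {r∉} h s = record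
      { U = U s ; U-size = U-size s ; U⊆L = U⊆L s
      ; new = t ∷ new s ; size-new = cong suc (size-new s)
      ; new-matching = matching (h ∷ areEdges (new-matching s))
                                (All.tabulate apart ∷ areDisjoint (new-matching s))
      ; located = loc }
      where
      t : Triple n
      t = point p ∷ point q ∷ point r ∷ []
      apart : ∀ {a} → a ∈ new s → VertexDisjoint t a
      apart a∈ 0F = avoids s (toWitness p∉) a∈
      apart a∈ 1F = avoids s (toWitness q∉) a∈
      apart a∈ 2F = avoids s (toWitness r∉) a∈
      loc : ∀ {a} → a ∈ t ∷ new s → ∀ i → (∃ λ x → x ∈ p ∷ q ∷ r ∷ W × at a i ≡ point x) ⊎ at a i ∈ U s
      loc (here refl) 0F = inj₁ (p , here refl , refl)
      loc (here refl) 1F = inj₁ (q , there (here refl) , refl)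
      loc (here refl) 2F = inj₁ (r , there (there (here refl)) , refl)
      loc (there a∈)  i with located s a∈ i
      ... | inj₁ (x , x∈ , e) = inj₁ (x , there (there (there x∈)) , e)
      ... | inj₂ l            = inj₂ l

    add-pair : ∀ {W u c} p q {_ : True (p ∉? W)} {_ : True (q ∉? W)} {_ : True (suc u ≤? 6)} →
               Γ (point p) (point q) ≡ true → State W u c → State (p ∷ q ∷ W) (suc u) (suc c)
    add-pair {W} p q {p∉} {q∉} {u<6} h s
      with Γ⇒fresh h (U s) (subst (_< 6) (sym (U-size s)) (toWitness u<6))
    ... | v , v∈L , e , v∉U = record
      { U = v ∷ U s ; U-size = cong suc (U-size s)
      ; U⊆L = λ { (here refl) → v∈L ; (there l) → U⊆L s l }
      ; new = t ∷ new s ; size-new = cong suc (size-new s)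
      ; new-matching = matching (e ∷ areEdges (new-matching s))
                                (All.tabulate apart ∷ areDisjoint (new-matching s))
      ; located = loc }
      where
      t : Triple n
      t = v ∷ point p ∷ point q ∷ []
      apart : ∀ {a} → a ∈ new s → VertexDisjoint t a
      apart a∈ 0F j e with located s a∈ j
      ... | inj₁ (y , _ , e′) = point≢leftover y v∈L (trans e e′)
      ... | inj₂ l            = v∉U (subst (_∈ U s) (sym e) l)
      apart a∈ 1F = avoids s (toWitness p∉) a∈
      apart a∈ 2F = avoids s (toWitness q∉) a∈
      loc : ∀ {a} → a ∈ t ∷ new s → ∀ i → (∃ λ x → x ∈ p ∷ q ∷ W × at a i ≡ point x) ⊎ at a i ∈ v ∷ U s
      loc (here refl) 0F = inj₂ (here refl)
      loc (here refl) 1F = inj₁ (p , here refl , refl)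
      loc (here refl) 2F = inj₁ (q , there (here refl) , refl)
      loc (there a∈)  i with located s a∈ i
      ... | inj₁ (x , x∈ , e) = inj₁ (x , there (there x∈) , e)
      ... | inj₂ l            = inj₂ (there l)

    impossible : ∀ {W u} → State W u (suc (length R)) → ⊥
    impossible s = no-augmentation (map triple R) (new s) in-M (new-matching s) where-new
      (trans (size-new s) (cong suc (sym (length-map triple R))))
      where
      in-M : ∀ {r} → r ∈ map triple R → r ∈ M
      in-M r∈ with ∈-map⁻ triple r∈
      ... | x , _ , refl = triple∈M x
      where-new : ∀ {a} → a ∈ new s → ∀ i →
        (∃ λ r → r ∈ map triple R × ∃ λ j → at a i ≡ at r j) ⊎ at a i ∈ L
      where-new a∈ i with located s a∈ i
      ... | inj₂ l = inj₂ (U⊆L s l)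
      ... | inj₁ ((r , j) , _ , e) =
        inj₁ (triple (List.lookup R r) , ∈-map⁺ triple (∈-lookup {xs = R} r) , relabel (List.lookup R r) j , e)

  plain : ∀ {e} → e ∈ M → LabelledEdge
  plain e∈ = labelled _ e∈ (λ i → i) (λ _ _ e → e)

  relabelled : ∀ {e u w} → e ∈ M → u ≢ w → LabelledEdge
  relabelled {u = u} {w} e∈ u≢w = labelled _ e∈ (label u w) (label-injective u≢w)

  swapΓ : ∀ {x y} → Γ x y ≡ true → Γ y x ≡ true
  swapΓ {x} {y} h = trans (Γ-sym y x) h

  no-perfect : ∀ {e f} → e ∈ M → f ∈ M → e ≢ f → hasPerfect (γ e f) ≡ false
  no-perfect {e} {f} e∈ f∈ e≢f with hasPerfect (γ e f) in eq
  ... | false = refl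
  ... | true with hasPerfect⇒ (γ e f) eq
  ...   | σ , inj , h = ⊥-elim (impossible
      (add-pair (0F , 0F) (1F , 0F) (h 0F)
      (add-pair (0F , 1F) (1F , 1F) (h 1F)
      (add-pair (0F , 2F) (1F , 2F) (h 2F) start))))
    where open Configuration (plain e∈ ∷ labelled f f∈ σ inj ∷ []) ((e≢f ∷ []) ∷ [] ∷ [])

  Cross-flip : ∀ {e f a c} → Cross (γ e f) a c → Cross (γ f e) c a
  Cross-flip x = record { row = λ j → swapΓ (Cross.col x j) ; col = λ i → swapΓ (Cross.row x i) }

  -- If `e` had two centres, a would go to `f` and a′ to `g`, the third vertex of `e` would be taken
  -- by a centre of `f` or `g`, and a pair between `f` and `g` would still be free: four pairs on
  -- three edges.
  centre-consistent : ∀ {e f g a a′ b b′ c c′} → e ∈ M → f ∈ M → g ∈ M → e ≢ f → e ≢ g → f ≢ g →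
    Cross (γ e f) a b → Cross (γ e g) a′ c → Cross (γ f g) b′ c′ → a ≡ a′
  centre-consistent {e} {f} {g} {a} {a′} {b} {b′} {c} {c′} e∈ f∈ g∈ e≢f e≢g f≢g ef eg fg
    with a ≟ꟳ a′ | b ≟ꟳ b′ | c ≟ꟳ c′
  ... | yes p | _ | _ = p
  -- Here b takes the third vertex of `e`, and the second centre b′ of `f` goes to `g`.
  ... | no a≢a′ | no b≢b′ | _ = ⊥-elim (impossible
      (add-pair (0F , 0F) (1F , 2F) (Cross.row ef _)
      (add-pair (0F , 1F) (2F , 0F) (Cross.row eg _)
      (add-pair (0F , 2F) (1F , 0F) (Cross.col ef _)
      (add-pair (1F , 1F) (2F , 1F) (Cross.row fg _) start)))))
    where open Configuration (relabelled e∈ a≢a′ ∷ relabelled f∈ b≢b′ ∷ plain g∈ ∷ [])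
                             ((e≢f ∷ e≢g ∷ []) ∷ (f≢g ∷ []) ∷ [] ∷ [])
  -- The same with `f` and `g` exchanged: c takes the third vertex of `e`, and c′ a vertex of `f`.
  ... | no a≢a′ | yes _ | no c≢c′ = ⊥-elim (impossible
      (add-pair (0F , 1F) (2F , 2F) (Cross.row eg _)
      (add-pair (0F , 0F) (1F , 0F) (Cross.row ef _)
      (add-pair (0F , 2F) (2F , 0F) (Cross.col eg _)
      (add-pair (1F , 1F) (2F , 1F) (Cross.col fg _) start)))))
    where open Configuration (relabelled e∈ a≢a′ ∷ plain f∈ ∷ relabelled g∈ c≢c′ ∷ [])
                             ((e≢f ∷ e≢g ∷ []) ∷ (f≢g ∷ []) ∷ [] ∷ [])
  -- Here b takes the third vertex of `e`, and c a vertex of `f`; a and a′ go to non-centres.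
  ... | no a≢a′ | yes refl | yes refl = ⊥-elim (impossible
      (add-pair (0F , 0F) (1F , 1F) (Cross.row ef _)
      (add-pair (0F , 1F) (2F , 1F) (Cross.row eg _)
      (add-pair (0F , 2F) (1F , 0F) (Cross.col ef _)
      (add-pair (1F , 2F) (2F , 0F) (Cross.col fg _) start)))))
    where open Configuration (relabelled e∈ a≢a′ ∷ relabelled f∈ (other-≢ b) ∷ relabelled g∈ (other-≢ c) ∷ [])
                             ((e≢f ∷ e≢g ∷ []) ∷ (f≢g ∷ []) ∷ [] ∷ [])

  -- The given edge leaves the centre and one more vertex on each of the three edges. The centres
  -- are paired cyclically with the other vertices, which makes four edges in place of three.
  no-edge-off-centres : ∀ {e f g a b c i j k} → e ∈ M → f ∈ M → g ∈ M → e ≢ f → e ≢ g → f ≢ g →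
    Cross (γ e f) a b → Cross (γ e g) a c → Cross (γ f g) b c →
    a ≢ i → b ≢ j → c ≢ k → E H (at e i) (at f j) (at g k) ≢ true
  no-edge-off-centres e∈ f∈ g∈ e≢f e≢g f≢g ef eg fg a≢i b≢j c≢k h = impossible
      (add-edge (0F , 1F) (1F , 1F) (2F , 1F) h
      (add-pair (0F , 0F) (1F , 2F) (Cross.row ef _)
      (add-pair (1F , 0F) (2F , 2F) (Cross.row fg _)
      (add-pair (0F , 2F) (2F , 0F) (Cross.col eg _) start))))
    where open Configuration (relabelled e∈ a≢i ∷ relabelled f∈ b≢j ∷ relabelled g∈ c≢k ∷ [])
                             ((e≢f ∷ e≢g ∷ []) ∷ (f≢g ∷ []) ∷ [] ∷ [])

  -- Between them f, g, h have six vertices to match into the six vertices of x and y: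
  -- h sends one vertex to each of x and y, f covers the rest of x and g the rest of y.
  no-three-sources : ∀ {f g h x y} → f ∈ M → g ∈ M → h ∈ M → x ∈ M → y ∈ M →
    Unique (f ∷ g ∷ h ∷ x ∷ y ∷ []) →
    Arc (γ f x) → Arc (γ g y) → Arc (γ h x) → Arc (γ h y) → ⊥
  no-three-sources {f} {g} {h} {x} {y} f∈ g∈ h∈ x∈ y∈ uniq fx gy hx hy = split second
    where
    module hx = Arc hx
    module hy = Arc hy

    -- `hx.full` is reserved for `x`, so a different vertex of `h` must reach `y`. The full source
    -- towards `y` serves unless it is the same vertex, and then the partial one does.
    second : ∃ λ p → hx.full ≢ p × ∃ λ r → γ h y p r ≡ true
    second with hx.full ≟ꟳ hy.full
    ... | no ≢f  = hy.full , ≢f , 0F , hy.full-adj 0F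
    ... | yes ≡f = hy.part , (λ e → hy.full≢part (trans (sym ≡f) e)) , other hy.missed ,
                   hy.part-adj _ (λ e → other-≢ hy.missed (sym e))

    split : (∃ λ p → hx.full ≢ p × ∃ λ r → γ h y p r ≡ true) → ⊥
    -- In `x` any vertex may be left for `h`, since `hx.full` is joined to all of them; in `y` it
    -- has to be r.
    split (p , u≢p , r , hr) with Arc-cover fx 0F | Arc-cover gy r
    ... | i , j , i≢j , e , fi , fj | i′ , j′ , i′≢j′ , e′ , gi , gj = impossible
        (add-pair (0F , 0F) (3F , 0F) fi
        (add-pair (0F , 1F) (3F , 1F) fj
        (add-pair (1F , 0F) (4F , 0F) gi
        (add-pair (1F , 1F) (4F , 1F) gj
        (add-pair (2F , 0F) (3F , 2F) (hx.full-adj _)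
        (add-pair (2F , 1F) (4F , 2F) (subst (λ q → γ h y p q ≡ true) e′ hr) start))))))
      where
      open Configuration
        (relabelled f∈ (Arc.full≢part fx) ∷ relabelled g∈ (Arc.full≢part gy) ∷ relabelled h∈ u≢p ∷
         relabelled x∈ i≢j ∷ relabelled y∈ i′≢j′ ∷ []) uniq

  no-edge-in-L : ∀ {u v w} → u ∈ L → v ∈ L → w ∈ L → E H u v w ≢ true
  no-edge-in-L {u} {v} {w} u∈ v∈ w∈ h =
    no-augmentation [] ((u ∷ v ∷ w ∷ []) ∷ []) (λ ()) (matching (h ∷ []) ([] ∷ [])) located refl
    where
    located : ∀ {a} → a ∈ (u ∷ v ∷ w ∷ []) ∷ [] → ∀ i → (∃ λ r → r ∈ [] × ∃ λ j → at a i ≡ at r j) ⊎ at a i ∈ L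
    located (here refl) 0F = inj₂ u∈
    located (here refl) 1F = inj₂ v∈
    located (here refl) 2F = inj₂ w∈

  -- Two such edges would be disjoint and could replace `e` alone.
  LLM-edges-meet : ∀ {e i j u v u′ v′} → e ∈ M → i ≢ j → u ∈ L → v ∈ L → u′ ∈ L → v′ ∈ L →
    E H u v (at e i) ≡ true → E H u′ v′ (at e j) ≡ true →
    u ≢ u′ → u ≢ v′ → v ≢ u′ → v ≢ v′ → ⊥
  LLM-edges-meet {e} {i} {j} {u} {v} {u′} {v′} e∈ i≢j u∈ v∈ u′∈ v′∈ h h′ n₁ n₂ n₃ n₄ =
    no-augmentation (e ∷ []) (t ∷ t′ ∷ []) (λ { (here refl) → e∈ })
      (matching (h ∷ h′ ∷ []) ((disj ∷ []) ∷ [] ∷ [])) located refl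
    where
    t t′ : Triple n
    t  = u ∷ v ∷ at e i ∷ []
    t′ = u′ ∷ v′ ∷ at e j ∷ []
    disj : VertexDisjoint t t′
    disj 0F 0F = n₁
    disj 0F 1F = n₂
    disj 0F 2F = leftover-≢ u∈ e∈
    disj 1F 0F = n₃
    disj 1F 1F = n₄
    disj 1F 2F = leftover-≢ v∈ e∈
    disj 2F 0F = λ q → leftover-≢ u′∈ e∈ (sym q)
    disj 2F 1F = λ q → leftover-≢ v′∈ e∈ (sym q)
    disj 2F 2F = λ q → i≢j (proj₂ (at-injective e∈ e∈ q))
    located : ∀ {a} → a ∈ t ∷ t′ ∷ [] → ∀ k →
      (∃ λ r → r ∈ e ∷ [] × ∃ λ l → at a k ≡ at r l) ⊎ at a k ∈ L
    located (here refl) 0F = inj₂ u∈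
    located (here refl) 1F = inj₂ v∈
    located (here refl) 2F = inj₁ (e , here refl , i , refl)
    located (there (here refl)) 0F = inj₂ u′∈
    located (there (here refl)) 1F = inj₂ v′∈
    located (there (here refl)) 2F = inj₁ (e , here refl , j , refl)

-- Counting degrees into the uncovered set

three-of-many : ∀ {A : Set} (p : A → Bool) {xs} → Unique xs → 3 ≤ ∑ xs (λ x → ⟦ p x ⟧) →
  ∃ λ x → ∃ λ y → ∃ λ z → Unique (x ∷ y ∷ z ∷ []) × All (λ w → w ∈ xs × p w ≡ true) (x ∷ y ∷ z ∷ [])
three-of-many p {xs} u h = pick (filterᵇ p xs) (filterᵇ-AllPairs p u) (λ x∈ → filterᵇ-∈ p xs x∈)
  (≤-trans h (≤-reflexive (sym (trans (length≡∑ (filterᵇ p xs))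
    (trans (∑-filterᵇ p xs (λ _ → 1)) (∑-cong xs λ x → *-identityʳ ⟦ p x ⟧))))))
  where
  pick : ∀ ys → Unique ys → (∀ {y} → y ∈ ys → y ∈ xs × p y ≡ true) → 3 ≤ length ys →
    ∃ λ x → ∃ λ y → ∃ λ z → Unique (x ∷ y ∷ z ∷ []) × All (λ w → w ∈ xs × p w ≡ true) (x ∷ y ∷ z ∷ [])
  pick (x ∷ y ∷ z ∷ _) ((x≢y ∷ x≢z ∷ _) ∷ (y≢z ∷ _) ∷ _) h _ =
    x , y , z , ((x≢y ∷ x≢z ∷ []) ∷ (y≢z ∷ []) ∷ [] ∷ []) ,
    h (here refl) ∷ h (there (here refl)) ∷ h (there (there (here refl))) ∷ []
  pick (_ ∷ []) _ _ (s≤s ())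
  pick (_ ∷ _ ∷ []) _ _ (s≤s (s≤s ()))

t*d≤t²+d² : ∀ t d → t * d ≤ t * t + d * d
t*d≤t²+d² t d with d ≤? t
... | yes d≤t = ≤-trans (*-monoʳ-≤ t d≤t) (m≤m+n _ _)
... | no d≰t  = ≤-trans (*-monoˡ-≤ d (<⇒≤ (≰⇒> d≰t))) (m≤n+m _ _)

⟦⟧-pos : ∀ b → 0 < ⟦ b ⟧ → b ≡ true
⟦⟧-pos true _ = refl

⟦∧⟧ : ∀ a b → ⟦ a ⟧ * ⟦ b ⟧ ≡ ⟦ a ∧ b ⟧
⟦∧⟧ false b     = refl
⟦∧⟧ true  false = refl
⟦∧⟧ true  true  = refl

module Counting {n : ℕ} (H : Hypergraph3 n) {M : List (Triple n)}
                (mat : Matching H M) (max : Maximum H M) where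

  open Links H mat max public

  m ℓ : ℕ
  m = length M
  ℓ = length L

  -- The diagonal counts as bad and is never an arc, so a good pair or an arc always consists of
  -- distinct edges.
  bad : Triple n → Triple n → Bool
  bad e f = does (e ≟₃ f) ∨ not (hasCross (γ e f))

  arc : Triple n → Triple n → Bool
  arc e f = not (does (e ≟₃ f)) ∧ hasArc (γ e f)

  #bad #arcs : ℕ
  #bad  = ∑ M λ e → ∑ M λ f → ⟦ bad e f ⟧
  #arcs = ∑ M λ e → ∑ M λ f → ⟦ arc e f ⟧

  arc⇒ : ∀ {e f} → arc e f ≡ true → e ≢ f × Arc (γ e f)
  arc⇒ {e} {f} h with e ≟₃ f
  ... | no e≢f = e≢f , hasArc⇒Arc (γ e f) h

  common-sources≤2 : ∀ {x y} → x ∈ M → y ∈ M → x ≢ y → ∑ M (λ f → ⟦ arc f x ⟧ * ⟦ arc f y ⟧) ≤ 2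
  common-sources≤2 {x} {y} x∈ y∈ x≢y = ≮⇒≥ λ lt → finish (three-of-many (λ f → arc f x ∧ arc f y) unique
      (≤-trans lt (≤-reflexive (∑-cong M λ f → ⟦∧⟧ (arc f x) (arc f y)))))
    where
    finish : (∃ λ f → ∃ λ g → ∃ λ h → Unique (f ∷ g ∷ h ∷ []) ×
               All (λ w → w ∈ M × (arc w x ∧ arc w y) ≡ true) (f ∷ g ∷ h ∷ [])) → ⊥
    finish (f , g , h , (f≢g ∷ f≢h ∷ []) ∷ (g≢h ∷ []) ∷ _ , (f∈ , pf) ∷ (g∈ , pg) ∷ (h∈ , ph) ∷ []) =
      let fx , fy = arcs pf
          gx , gy = arcs pg
          hx , hy = arcs ph
      in no-three-sources f∈ g∈ h∈ x∈ y∈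
           ((f≢g ∷ f≢h ∷ proj₁ fx ∷ proj₁ fy ∷ []) ∷ (g≢h ∷ proj₁ gx ∷ proj₁ gy ∷ []) ∷
            (proj₁ hx ∷ proj₁ hy ∷ []) ∷ (x≢y ∷ []) ∷ [] ∷ [])
           (proj₂ fx) (proj₂ gy) (proj₂ hx) (proj₂ hy)
      where
      arcs : ∀ {w} → (arc w x ∧ arc w y) ≡ true → (w ≢ x × Arc (γ w x)) × (w ≢ y × Arc (γ w y))
      arcs {w} p = arc⇒ (proj₁ (∧-elim {arc w x} p)) , arc⇒ (proj₂ (∧-elim {arc w x} p))

  outdegree : Triple n → ℕ
  outdegree f = ∑ M λ x → ⟦ arc f x ⟧

  -- The square counts pairs of arcs with a common source. Sorted by their targets, there are at
  -- most 2 sources for distinct targets and at most m for equal ones: 2 m² + m · m.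
  ∑-outdegree² : ∑ M (λ f → outdegree f * outdegree f) ≤ 3 * (m * m)
  ∑-outdegree² = begin
    ∑ M (λ f → outdegree f * outdegree f)
      ≡⟨ ∑-cong M (λ f → trans (sym (∑-*ʳ M (outdegree f) _)) (∑-cong M λ x → sym (∑-*ˡ M ⟦ arc f x ⟧ _))) ⟩
    ∑ M (λ f → ∑ M λ x → ∑ M λ y → ⟦ arc f x ⟧ * ⟦ arc f y ⟧)
      ≡⟨ ∑-swap M M _ ⟩
    ∑ M (λ x → ∑ M λ f → ∑ M λ y → ⟦ arc f x ⟧ * ⟦ arc f y ⟧)
      ≡⟨ ∑-cong M (λ x → ∑-swap M M _) ⟩
    ∑ M (λ x → ∑ M λ y → ∑ M λ f → ⟦ arc f x ⟧ * ⟦ arc f y ⟧)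
      ≤⟨ ∑-mono-∈ M (λ x x∈ → ∑-mono-∈ M λ y y∈ → pair x∈ y∈) ⟩
    ∑ M (λ x → ∑ M λ y → 2 + δ _≟₃_ y x * m)
      ≡⟨ ∑-cong M (λ x → trans (∑-+ M (λ _ → 2) _) (cong₂ _+_ (∑-const M 2) (∑-*ʳ M m _))) ⟩
    ∑ M (λ x → m * 2 + ∑ M (λ y → δ _≟₃_ y x) * m)
      ≤⟨ ∑-bound M (λ x _ → +-monoʳ-≤ (m * 2) (*-monoˡ-≤ m (∑-δ≤1 _≟₃_ unique x))) ⟩
    m * (m * 2 + 1 * m)
      ≡⟨ ring m ⟩
    3 * (m * m) ∎
    where
    open ≤-Reasoning
    ring : ∀ m → m * (m * 2 + 1 * m) ≡ 3 * (m * m)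
    ring = solve-∀
    pair : ∀ {x y} → x ∈ M → y ∈ M → ∑ M (λ f → ⟦ arc f x ⟧ * ⟦ arc f y ⟧) ≤ 2 + δ _≟₃_ y x * m
    pair {x} {y} x∈ y∈ with y ≟₃ x
    ... | no y≢x = ≤-trans (common-sources≤2 x∈ y∈ (λ e → y≢x (sym e))) (m≤m+n 2 0)
    ... | yes _  = ≤-trans (∑-bound M (λ f _ → *-mono-≤ (⟦⟧≤1 (arc f x)) (⟦⟧≤1 (arc f y))))
                     (≤-trans (≤-reflexive (trans (*-identityʳ m) (sym (+-identityʳ m)))) (m≤n+m (m + 0) 2))

  -- The bound on squares linearised with a free parameter t, in place of Cauchy-Schwarz and its
  -- square root. A large constant t makes the arcs a small fraction of n².
  #arcs-bound : ∀ t → t * #arcs ≤ m * (t * t) + 3 * (m * m)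
  #arcs-bound t = begin
    t * #arcs                                          ≡⟨ sym (∑-*ˡ M t outdegree) ⟩
    ∑ M (λ f → t * outdegree f)                        ≤⟨ ∑-mono M (λ f → t*d≤t²+d² t (outdegree f)) ⟩
    ∑ M (λ f → t * t + outdegree f * outdegree f)      ≡⟨ ∑-+ M _ _ ⟩
    ∑ M (λ f → t * t) + ∑ M (λ f → outdegree f * outdegree f)
                                                       ≤⟨ +-mono-≤ (≤-reflexive (∑-const M (t * t))) ∑-outdegree² ⟩
    m * (t * t) + 3 * (m * m)                          ∎
    where open ≤-Reasoning

  LLedges : Triple n → Fin 3 → ℕ
  LLedges e i = ∑ L λ u → ∑ L λ v → ⟦ E H u v (at e i) ⟧

  LLedges≤ℓ² : ∀ e i → LLedges e i ≤ ℓ * ℓ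
  LLedges≤ℓ² e i = ∑-bound L λ u _ → ≤-trans (∑-bound L λ v _ → ⟦⟧≤1 _) (≤-reflexive (*-identityʳ ℓ))

  -- Every such pair meets the fixed pair u′v′.
  LLedges≤4ℓ : ∀ {e i j} → e ∈ M → i ≢ j → 0 < LLedges e j → LLedges e i ≤ 4 * ℓ
  LLedges≤4ℓ {e} {i} {j} e∈ i≢j pos with ∑-pos⇒∃ L _ pos
  ... | u′ , u′∈ , pos′ with ∑-pos⇒∃ L _ pos′
  ...   | v′ , v′∈ , pos″ = begin
      LLedges e i
        ≤⟨ ∑-mono-∈ L (λ u u∈ → ∑-mono-∈ L λ v v∈ → pointwise u∈ v∈) ⟩
      ∑ L (λ u → ∑ L λ v → (d u u′ + d u v′) + (d v u′ + d v v′))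
        ≡⟨ ∑-cong L (λ u → ∑-+ L _ _) ⟩
      ∑ L (λ u → ∑ L (λ v → d u u′ + d u v′) + ∑ L (λ v → d v u′ + d v v′))
        ≡⟨ ∑-+ L _ _ ⟩
      ∑ L (λ u → ∑ L (λ v → d u u′ + d u v′)) + ∑ L (λ u → ∑ L (λ v → d v u′ + d v v′))
        ≡⟨ cong (_+ ∑ L (λ u → ∑ L (λ v → d v u′ + d v v′))) (∑-swap L L _) ⟩
      ∑ L (λ v → ∑ L (λ u → d u u′ + d u v′)) + ∑ L (λ u → ∑ L (λ v → d v u′ + d v v′))
        ≤⟨ +-mono-≤ (∑-bound L λ _ _ → two) (∑-bound L λ _ _ → two) ⟩
      ℓ * 2 + ℓ * 2
        ≡⟨ ring ℓ ⟩
      4 * ℓ ∎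
    where
    open ≤-Reasoning
    d : Fin n → Fin n → ℕ
    d = δ _≟ꟳ_
    ring : ∀ l → l * 2 + l * 2 ≡ 4 * l
    ring = solve-∀
    two : ∑ L (λ u → d u u′ + d u v′) ≤ 2
    two = ≤-trans (≤-reflexive (∑-+ L _ _))
      (+-mono-≤ (∑-δ≤1 _≟ꟳ_ leftover-unique u′) (∑-δ≤1 _≟ꟳ_ leftover-unique v′))
    edge′ : E H u′ v′ (at e j) ≡ true
    edge′ = ⟦⟧-pos _ pos″
    pointwise : ∀ {u v} → u ∈ L → v ∈ L → ⟦ E H u v (at e i) ⟧ ≤ (d u u′ + d u v′) + (d v u′ + d v v′)
    pointwise {u} {v} u∈ v∈ with E H u v (at e i) in eq
    ... | false = z≤n
    ... | true with u ≟ꟳ u′ | u ≟ꟳ v′ | v ≟ꟳ u′ | v ≟ꟳ v′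
    ...   | yes _ | _     | _     | _     = s≤s z≤n
    ...   | no _  | yes _ | _     | _     = s≤s z≤n
    ...   | no _  | no _  | yes _ | _     = s≤s z≤n
    ...   | no _  | no _  | no _  | yes _ = s≤s z≤n
    ...   | no a  | no b  | no c  | no d  = ⊥-elim (LLM-edges-meet e∈ i≢j u∈ v∈ u′∈ v′∈ eq edge′ a b c d)

  -- Either one vertex of `e` carries all these edges, or two carry some, and then each of the three
  -- is limited to 4 ℓ. The leading coefficient 1 instead of 3 is what the threshold 5/9 tolerates.
  ∑-LLedges : ∀ {e} → e ∈ M → ∑ (allFin 3) (LLedges e) ≤ ℓ * ℓ + 12 * ℓ
  ∑-LLedges {e} e∈ = cases
    (LLedges e 0F) (LLedges e 1F) (LLedges e 2F) refl refl refl
    where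
    few : ∀ {i j} → i ≢ j → 0 < LLedges e j → LLedges e i ≤ 4 * ℓ
    few = LLedges≤4ℓ e∈
    ring₃ : ∀ l → 4 * l + (4 * l + (4 * l + 0)) ≡ 12 * l
    ring₃ = solve-∀
    g : Fin 3 → ℕ
    g = LLedges e
    three : g 0F ≤ 4 * ℓ → g 1F ≤ 4 * ℓ → g 2F ≤ 4 * ℓ → ∑ (allFin 3) g ≤ ℓ * ℓ + 12 * ℓ
    three a b c = ≤-trans (+-mono-≤ a (+-mono-≤ b (+-mono-≤ c z≤n)))
      (≤-trans (≤-reflexive (ring₃ ℓ)) (m≤n+m (12 * ℓ) (ℓ * ℓ)))
    one : ∀ i → ∑ (allFin 3) g ≡ g i → ∑ (allFin 3) g ≤ ℓ * ℓ + 12 * ℓ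
    one i eq = ≤-trans (≤-reflexive eq) (≤-trans (LLedges≤ℓ² e i) (m≤m+n (ℓ * ℓ) (12 * ℓ)))
    pos : ∀ {i k} → g i ≡ suc k → 0 < g i
    pos eq = subst (0 <_) (sym eq) (s≤s z≤n)
    cases : ∀ a b c → g 0F ≡ a → g 1F ≡ b → g 2F ≡ c → ∑ (allFin 3) g ≤ ℓ * ℓ + 12 * ℓ
    cases a zero zero e₀ e₁ e₂ = one 0F (trans (cong (g 0F +_) (cong₂ _+_ e₁ (cong (_+ 0) e₂))) (+-identityʳ (g 0F)))
    cases zero b zero e₀ e₁ e₂ = one 1F (trans (cong₂ _+_ e₀ (cong (g 1F +_) (cong (_+ 0) e₂))) (+-identityʳ (g 1F)))
    cases zero zero c e₀ e₁ e₂ = one 2F (trans (cong₂ _+_ e₀ (cong (_+ (g 2F + 0)) e₁)) (+-identityʳ (g 2F)))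
    cases (suc a) (suc b) c e₀ e₁ e₂ = three (few (λ ()) (pos e₁)) (few (λ ()) (pos e₀)) (few {j = 0F} (λ ()) (pos e₀))
    cases (suc a) zero (suc c) e₀ e₁ e₂ = three (few (λ ()) (pos e₂)) (few {j = 0F} (λ ()) (pos e₀)) (few (λ ()) (pos e₀))
    cases zero (suc b) (suc c) e₀ e₁ e₂ = three (few {j = 1F} (λ ()) (pos e₁)) (few (λ ()) (pos e₂)) (few (λ ()) (pos e₁))

  pairDegree : Triple n → Triple n → ℕ
  pairDegree e f = ∑ (allFin 3) λ i → ∑ (allFin 3) λ j → codegree (at e i) (at f j)

  codegree≤ : ∀ x y → codegree x y ≤ ℓ * ⟦ Γ x y ⟧ + 6
  codegree≤ x y with 6 ≤? codegree x y
  ... | no lt = ≤-trans (<⇒≤ (≰⇒> lt)) (m≤n+m 6 _)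
  ... | yes ge with Γ x y | ≤⇒≤ᵇ ge
  ...   | true | _ = ≤-trans (∑-bound L λ v _ → ⟦⟧≤1 _) (m≤m+n (ℓ * 1) 6)

  pairDegree≤size : ∀ e f → pairDegree e f ≤ ℓ * size (γ e f) + 54
  pairDegree≤size e f = begin
    pairDegree e f
      ≤⟨ ∑-mono (allFin 3) (λ i → ∑-mono (allFin 3) λ j → codegree≤ (at e i) (at f j)) ⟩
    ∑ (allFin 3) (λ i → ∑ (allFin 3) λ j → ℓ * ⟦ γ e f i j ⟧ + 6)
      ≡⟨ ∑-cong (allFin 3) (λ i → trans (∑-+ (allFin 3) (λ j → ℓ * ⟦ γ e f i j ⟧) (λ _ → 6))
           (cong (_+ 18) (∑-*ˡ (allFin 3) ℓ (λ j → ⟦ γ e f i j ⟧)))) ⟩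
    ∑ (allFin 3) (λ i → ℓ * ∑ (allFin 3) (λ j → ⟦ γ e f i j ⟧) + 18)
      ≡⟨ trans (∑-+ (allFin 3) (λ i → ℓ * ∑ (allFin 3) (λ j → ⟦ γ e f i j ⟧)) (λ _ → 18))
           (cong (_+ 54) (∑-*ˡ (allFin 3) ℓ (λ i → ∑ (allFin 3) (λ j → ⟦ γ e f i j ⟧)))) ⟩
    ℓ * size (γ e f) + 54 ∎
    where open ≤-Reasoning

  size≤9 : ∀ (g : Graph₃) → size g ≤ 9
  size≤9 g = ∑-bound (allFin 3) {c = 3} λ i _ → ∑-bound (allFin 3) {c = 1} λ j _ → ⟦⟧≤1 (g i j)

  -- Designed to bound `size` plus `bad`: apart from arcs, a non-cross has at most 4 pairs, and the
  -- unit below 5 pays for its being bad. On the diagonal 9 + 1 = 5 + 5.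
  pairWeight : Triple n → Triple n → ℕ
  pairWeight e f = 5 + 2 * ⟦ arc e f ⟧ + 2 * ⟦ arc f e ⟧ + 5 * δ _≟₃_ f e

  size+bad≤ : ∀ {e f} → e ∈ M → f ∈ M → size (γ e f) + ⟦ bad e f ⟧ ≤ pairWeight e f
  size+bad≤ {e} {f} e∈ f∈ with e ≟₃ f | f ≟₃ e
  ... | yes _ | yes _ = +-monoˡ-≤ 1 (size≤9 (γ e f))
  ... | yes p | no ¬q = contradiction (sym p) ¬q
  ... | no ¬p | yes q = contradiction (sym q) ¬p
  ... | no e≢f | no _ = begin
      size (γ e f) + ⟦ not (hasCross (γ e f)) ⟧
        ≤⟨ +-monoˡ-≤ ⟦ not (hasCross (γ e f)) ⟧ (size≤ (γ e f) (no-perfect e∈ f∈ e≢f)) ⟩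
      4 + ⟦ hasCross (γ e f) ⟧ + 2 * ⟦ hasArc (γ e f) ⟧ + 2 * ⟦ hasArc (γ e f ᵀ) ⟧ + ⟦ not (hasCross (γ e f)) ⟧
        ≡⟨ regroup (hasCross (γ e f)) ⟦ hasArc (γ e f) ⟧ ⟦ hasArc (γ e f ᵀ) ⟧ ⟩
      5 + 2 * ⟦ hasArc (γ e f) ⟧ + 2 * ⟦ hasArc (γ e f ᵀ) ⟧ + 0
        ≡⟨ cong (λ b → 5 + 2 * ⟦ hasArc (γ e f) ⟧ + 2 * ⟦ b ⟧ + 0)
             (hasArc-cong {γ e f ᵀ} {γ f e} λ i j → Γ-sym (at e j) (at f i)) ⟩
      5 + 2 * ⟦ hasArc (γ e f) ⟧ + 2 * ⟦ hasArc (γ f e) ⟧ + 0 ∎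
    where
    open ≤-Reasoning
    r₁ : ∀ a b → 4 + 1 + 2 * a + 2 * b + 0 ≡ 5 + 2 * a + 2 * b + 0
    r₁ = solve-∀
    r₂ : ∀ a b → 4 + 0 + 2 * a + 2 * b + 1 ≡ 5 + 2 * a + 2 * b + 0
    r₂ = solve-∀
    regroup : ∀ c a b → 4 + ⟦ c ⟧ + 2 * a + 2 * b + ⟦ not c ⟧ ≡ 5 + 2 * a + 2 * b + 0
    regroup true  a b = r₁ a b
    regroup false a b = r₂ a b

  pairDegree-bound : ∀ {e f} → e ∈ M → f ∈ M →
    pairDegree e f + ℓ * ⟦ bad e f ⟧ ≤ ℓ * pairWeight e f + 54
  pairDegree-bound {e} {f} e∈ f∈ = begin
    pairDegree e f + ℓ * ⟦ bad e f ⟧              ≤⟨ +-monoˡ-≤ _ (pairDegree≤size e f) ⟩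
    ℓ * size (γ e f) + 54 + ℓ * ⟦ bad e f ⟧       ≡⟨ ring ℓ (size (γ e f)) ⟦ bad e f ⟧ ⟩
    ℓ * (size (γ e f) + ⟦ bad e f ⟧) + 54         ≤⟨ +-monoˡ-≤ 54 (*-monoʳ-≤ ℓ (size+bad≤ e∈ f∈)) ⟩
    ℓ * pairWeight e f + 54                       ∎
    where
    open ≤-Reasoning
    ring : ∀ l s b → l * s + 54 + l * b ≡ l * (s + b) + 54
    ring = solve-∀

  ∑∑-pairWeight : ∑ M (λ e → ∑ M λ f → pairWeight e f) ≤ 5 * (m * m) + 4 * #arcs + 5 * m
  ∑∑-pairWeight = begin
    ∑ M (λ e → ∑ M λ f → pairWeight e f)
      ≡⟨ ∑-cong M (λ e → trans (∑-+ M _ _) (cong₂ _+_ (trans (∑-+ M _ _) (cong₂ _+_ (trans (∑-+ M (λ _ → 5) _)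
           (cong₂ _+_ (∑-const M 5) (∑-*ˡ M 2 _))) (∑-*ˡ M 2 _))) (∑-*ˡ M 5 _))) ⟩
    ∑ M (λ e → m * 5 + 2 * outdegree e + 2 * ∑ M (λ f → ⟦ arc f e ⟧) + 5 * ∑ M (λ f → δ _≟₃_ f e))
      ≤⟨ ∑-mono M (λ e → +-monoʳ-≤ (m * 5 + 2 * outdegree e + 2 * ∑ M (λ f → ⟦ arc f e ⟧))
           (*-monoʳ-≤ 5 (∑-δ≤1 _≟₃_ unique e))) ⟩
    ∑ M (λ e → m * 5 + 2 * outdegree e + 2 * ∑ M (λ f → ⟦ arc f e ⟧) + 5)
      ≡⟨ trans (∑-+ M _ _) (cong₂ _+_ (trans (∑-+ M _ _) (cong₂ _+_ (trans (∑-+ M (λ _ → m * 5) _)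
           (cong₂ _+_ (∑-const M (m * 5)) (∑-*ˡ M 2 _))) (∑-*ˡ M 2 _))) (∑-const M 5)) ⟩
    m * (m * 5) + 2 * #arcs + 2 * ∑ M (λ e → ∑ M (λ f → ⟦ arc f e ⟧)) + m * 5
      ≡⟨ cong (λ a → m * (m * 5) + 2 * #arcs + 2 * a + m * 5) (∑-swap M M _) ⟩
    m * (m * 5) + 2 * #arcs + 2 * #arcs + m * 5
      ≡⟨ ring m #arcs ⟩
    5 * (m * m) + 4 * #arcs + 5 * m ∎
    where
    open ≤-Reasoning
    ring : ∀ m a → m * (m * 5) + 2 * a + 2 * a + m * 5 ≡ 5 * (m * m) + 4 * a + 5 * m
    ring = solve-∀

  ∑∑-pairDegree : ∑ M (λ e → ∑ M λ f → pairDegree e f) + ℓ * #bad ≤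
                  ℓ * (5 * (m * m) + 4 * #arcs + 5 * m) + 54 * (m * m)
  ∑∑-pairDegree = begin
    ∑ M (λ e → ∑ M λ f → pairDegree e f) + ℓ * #bad
      ≡⟨ cong (∑ M (λ e → ∑ M λ f → pairDegree e f) +_) (trans (sym (∑-*ˡ M ℓ _)) (∑-cong M λ e → sym (∑-*ˡ M ℓ _))) ⟩
    ∑ M (λ e → ∑ M λ f → pairDegree e f) + ∑ M (λ e → ∑ M λ f → ℓ * ⟦ bad e f ⟧)
      ≡⟨ trans (sym (∑-+ M _ _)) (∑-cong M λ e → sym (∑-+ M _ _)) ⟩
    ∑ M (λ e → ∑ M λ f → pairDegree e f + ℓ * ⟦ bad e f ⟧)
      ≤⟨ ∑-mono-∈ M (λ e e∈ → ∑-mono-∈ M λ f f∈ → pairDegree-bound e∈ f∈) ⟩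
    ∑ M (λ e → ∑ M λ f → ℓ * pairWeight e f + 54)
      ≡⟨ ∑-cong M (λ e → trans (∑-+ M _ _) (cong₂ _+_ (∑-*ˡ M ℓ _) (∑-const M 54))) ⟩
    ∑ M (λ e → ℓ * ∑ M (pairWeight e) + m * 54)
      ≡⟨ trans (∑-+ M _ _) (cong₂ _+_ (∑-*ˡ M ℓ _) (∑-const M (m * 54))) ⟩
    ℓ * ∑ M (λ e → ∑ M (pairWeight e)) + m * (m * 54)
      ≤⟨ +-mono-≤ (*-monoʳ-≤ ℓ ∑∑-pairWeight) (≤-reflexive (ring m)) ⟩
    ℓ * (5 * (m * m) + 4 * #arcs + 5 * m) + 54 * (m * m) ∎
    where
    open ≤-Reasoning
    ring : ∀ m → m * (m * 54) ≡ 54 * (m * m)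
    ring = solve-∀

  vertices : Triple n → List (Fin n)
  vertices e = at e 0F ∷ at e 1F ∷ at e 2F ∷ []

  VM : List (Fin n)
  VM = concatMap vertices M

  ∑V : ∀ (f : Fin n → ℕ) → ∑ (allFin n) f ≡ ∑ L f + ∑ VM f
  ∑V f = trans (∑-partition f) (cong (∑ L f +_) (sym (∑-concatMap vertices M f)))

  -- Split by whether each of the other two vertices is covered. No edge lies inside `L`, and the
  -- two mixed cases agree by symmetry, whence the factor 2.
  ∑-orderedDeg : ∑ L (orderedDeg H) ≡
    2 * ∑ M (λ e → ∑ (allFin 3) (LLedges e)) + ∑ M (λ e → ∑ M λ f → pairDegree e f)
  ∑-orderedDeg = begin
    ∑ L (orderedDeg H)
      ≡⟨ ∑-cong L (λ v → trans (∑V _) (cong₂ _+_ (trans (∑-cong L λ y → ∑V _) (∑-+ L _ _))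
                                               (trans (∑-cong VM λ y → ∑V _) (∑-+ VM _ _)))) ⟩
    ∑ L (λ v → (∑ L (λ y → ∑ L λ z → t v y z) + ∑ L (λ y → ∑ VM λ z → t v y z))
             + (∑ VM (λ y → ∑ L λ z → t v y z) + ∑ VM (λ y → ∑ VM λ z → t v y z)))
      ≡⟨ trans (∑-+ L _ _) (cong₂ _+_ (∑-+ L _ _) (∑-+ L _ _)) ⟩
    (∑ L (λ v → ∑ L (λ y → ∑ L λ z → t v y z)) + ∑ L (λ v → ∑ L (λ y → ∑ VM λ z → t v y z)))
      + (∑ L (λ v → ∑ VM (λ y → ∑ L λ z → t v y z)) + ∑ L (λ v → ∑ VM (λ y → ∑ VM λ z → t v y z)))
      ≡⟨ cong₂ _+_ (cong₂ _+_ LLL LLM) (cong₂ _+_ LML LMM) ⟩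
    (0 + X) + (X + Y)
      ≡⟨ ring X Y ⟩
    2 * X + Y ∎
    where
    open ≡-Reasoning
    t : Fin n → Fin n → Fin n → ℕ
    t v y z = ⟦ E H v y z ⟧
    X Y : ℕ
    X = ∑ M (λ e → ∑ (allFin 3) (LLedges e))
    Y = ∑ M (λ e → ∑ M λ f → pairDegree e f)
    ring : ∀ x y → (0 + x) + (x + y) ≡ 2 * x + y
    ring = solve-∀
    absent : ∀ {v y z} → v ∈ L → y ∈ L → z ∈ L → t v y z ≡ 0
    absent {v} {y} {z} v∈ y∈ z∈ with E H v y z in eq
    ... | false = refl
    ... | true  = contradiction eq (no-edge-in-L v∈ y∈ z∈)
    LLL : ∑ L (λ v → ∑ L (λ y → ∑ L λ z → t v y z)) ≡ 0
    LLL = ∑-zero L λ v v∈ → ∑-zero L λ y y∈ → ∑-zero L λ z z∈ → absent v∈ y∈ z∈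
    LLM : ∑ L (λ v → ∑ L (λ y → ∑ VM λ z → t v y z)) ≡ X
    LLM = begin
      ∑ L (λ v → ∑ L (λ y → ∑ VM λ z → t v y z)) ≡⟨ ∑-cong L (λ v → ∑-swap L VM _) ⟩
      ∑ L (λ v → ∑ VM (λ z → ∑ L λ y → t v y z)) ≡⟨ ∑-swap L VM _ ⟩
      ∑ VM (λ z → ∑ L λ v → ∑ L λ y → t v y z)   ≡⟨ ∑-concatMap vertices M (λ z → ∑ L λ v → ∑ L λ y → t v y z) ⟩
      X                                          ∎
    LML : ∑ L (λ v → ∑ VM (λ y → ∑ L λ z → t v y z)) ≡ X
    LML = trans (∑-cong L λ v → trans (∑-swap VM L _)
            (∑-cong L λ y → ∑-cong VM λ z → cong ⟦_⟧ (E-swap₂₃ H v z y))) LLM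
    LMM : ∑ L (λ v → ∑ VM (λ y → ∑ VM λ z → t v y z)) ≡ Y
    LMM = begin
      ∑ L (λ v → ∑ VM (λ y → ∑ VM λ z → t v y z))     ≡⟨ ∑-swap L VM _ ⟩
      ∑ VM (λ y → ∑ L λ v → ∑ VM λ z → t v y z)       ≡⟨ ∑-cong VM (λ y → ∑-swap L VM _) ⟩
      ∑ VM (λ y → ∑ VM λ z → codegree y z)            ≡⟨ ∑-concatMap vertices M (λ y → ∑ VM (codegree y)) ⟩
      ∑ M (λ e → ∑ (allFin 3) λ i → ∑ VM λ z → codegree (at e i) z)
        ≡⟨ ∑-cong M (λ e → ∑-cong (allFin 3) λ i → ∑-concatMap vertices M (codegree (at e i))) ⟩
      ∑ M (λ e → ∑ (allFin 3) λ i → ∑ M λ f → ∑ (allFin 3) λ j → codegree (at e i) (at f j))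
        ≡⟨ ∑-cong M (λ e → ∑-swap (allFin 3) M (λ i f → ∑ (allFin 3) λ j → codegree (at e i) (at f j))) ⟩
      Y ∎

  degree-sum : ∑ L (orderedDeg H) + ℓ * #bad ≤
    2 * (m * (ℓ * ℓ + 12 * ℓ)) + (ℓ * (5 * (m * m) + 4 * #arcs + 5 * m) + 54 * (m * m))
  degree-sum = begin
    ∑ L (orderedDeg H) + ℓ * #bad       ≡⟨ cong (_+ ℓ * #bad) ∑-orderedDeg ⟩
    2 * X + Y + ℓ * #bad                ≡⟨ +-assoc (2 * X) Y (ℓ * #bad) ⟩
    2 * X + (Y + ℓ * #bad)              ≤⟨ +-mono-≤ (*-monoʳ-≤ 2 (∑-bound M λ e e∈ → ∑-LLedges e∈)) ∑∑-pairDegree ⟩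
    2 * (m * (ℓ * ℓ + 12 * ℓ)) + (ℓ * (5 * (m * m) + 4 * #arcs + 5 * m) + 54 * (m * m)) ∎
    where
    open ≤-Reasoning
    X Y : ℕ
    X = ∑ M (λ e → ∑ (allFin 3) (LLedges e))
    Y = ∑ M (λ e → ∑ M λ f → pairDegree e f)

-- The set of non-centres

∣∣≡∑ : ∀ {n} (S : Subset n) → ∣ S ∣ ≡ ∑ (allFin n) (λ v → ⟦ Vec.lookup S v ⟧)
∣∣≡∑ Vec.[] = refl
∣∣≡∑ {suc n} (b Vec.∷ S) = trans (head b) (cong (⟦ b ⟧ +_) (trans (∣∣≡∑ S)
  (trans (sym (∑-map suc (allFin n) (λ v → ⟦ Vec.lookup (b Vec.∷ S) v ⟧)))
    (cong (λ vs → ∑ vs (λ v → ⟦ Vec.lookup (b Vec.∷ S) v ⟧)) (map-tabulate (λ i → i) suc)))))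
  where
  head : ∀ b → ∣ b Vec.∷ S ∣ ≡ ⟦ b ⟧ + ∣ S ∣
  head true  = refl
  head false = refl

squares-≤ : ∀ {a b} → a * a ≤ b * b → a ≤ b
squares-≤ h = ≮⇒≥ λ lt → <⇒≱ (*-mono-< lt lt) h

-- The terms 18 K m ℓ² + 45 K ℓ m² on the two sides are equal: this is where 5/9 enters.
degree-arithmetic : ∀ K q n m ℓ b a S → n ≡ ℓ + 3 * m → 0 < ℓ → n ≤ q * ℓ →
  ℓ * (5 * K * (n * n)) ≤ 9 * K * S + ℓ * (n * n + 5 * K * n) →
  S + ℓ * b ≤ 2 * (m * (ℓ * ℓ + 12 * ℓ)) + (ℓ * (5 * (m * m) + 4 * a + 5 * m) + 54 * (m * m)) →
  36 * K * a ≤ n * n → K * (266 + 486 * q) ≤ n →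
  9 * K * b + 5 * K * (ℓ * ℓ) ≤ 3 * (n * n)
degree-arithmetic K q n m ℓ b a S refl 0<ℓ n≤qℓ hdeg hsum ha hn =
  *-cancelˡ-≤ ℓ {{>-nonZero 0<ℓ}} (begin
    ℓ * (9 * K * b + 5 * K * (ℓ * ℓ))
      ≤⟨ +-cancelʳ-≤ common _ _ cancelled ⟩
    ℓ * (261 * K * m + 36 * K * a + n * n + 5 * K * n) + 486 * K * (m * m)
      -- The allowance of 6 for each pair outside `Γ` leaves 486 K m² with 486 = 9 · 54, without a
      -- factor ℓ. The estimate m ≤ n ≤ q ℓ supplies one, so that ℓ can be cancelled. The 261 is 9
      -- (24 + 5).
      ≤⟨ +-mono-≤ (*-monoʳ-≤ ℓ (+-monoˡ-≤ (5 * K * n) (+-monoˡ-≤ (n * n) (+-mono-≤ (*-monoʳ-≤ (261 * K) m≤n) ha))))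
                  (*-monoʳ-≤ (486 * K) (*-mono-≤ (≤-trans m≤n n≤qℓ) m≤n)) ⟩
    ℓ * (261 * K * n + n * n + n * n + 5 * K * n) + 486 * K * (q * ℓ * n)
      ≡⟨ ring₃ K q n ℓ ⟩
    ℓ * (n * n + n * n + K * (266 + 486 * q) * n)
      ≤⟨ *-monoʳ-≤ ℓ (+-monoʳ-≤ (n * n + n * n) (*-monoˡ-≤ n hn)) ⟩
    ℓ * (n * n + n * n + n * n)
      ≡⟨ cong (ℓ *_) (ring₄ (n * n)) ⟩
    ℓ * (3 * (n * n)) ∎)
  where
  open ≤-Reasoning
  common : ℕ
  common = 18 * K * (m * (ℓ * ℓ)) + 45 * K * (ℓ * (m * m))
  m≤n : m ≤ n
  m≤n = ≤-trans (m≤m+n m _) (m≤n+m (3 * m) ℓ)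
  ring₁ : ∀ K m ℓ b → ℓ * (9 * K * b + 5 * K * (ℓ * ℓ)) + (18 * K * (m * (ℓ * ℓ)) + 45 * K * (ℓ * (m * m))) + 12 * K * (m * (ℓ * ℓ))
        ≡ ℓ * (5 * K * ((ℓ + 3 * m) * (ℓ + 3 * m))) + 9 * K * (ℓ * b)
  ring₁ = solve-∀
  ring₂ : ∀ K m ℓ a n → 9 * K * (2 * (m * (ℓ * ℓ + 12 * ℓ)) + (ℓ * (5 * (m * m) + 4 * a + 5 * m) + 54 * (m * m))) + ℓ * (n * n + 5 * K * n)
        ≡ ℓ * (261 * K * m + 36 * K * a + n * n + 5 * K * n) + 486 * K * (m * m) + (18 * K * (m * (ℓ * ℓ)) + 45 * K * (ℓ * (m * m)))
  ring₂ = solve-∀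
  ring₃ : ∀ K q n ℓ → ℓ * (261 * K * n + n * n + n * n + 5 * K * n) + 486 * K * (q * ℓ * n)
        ≡ ℓ * (n * n + n * n + K * (266 + 486 * q) * n)
  ring₃ = solve-∀
  ring₄ : ∀ x → x + x + x ≡ 3 * x
  ring₄ = solve-∀
  ring₅ : ∀ K S l b r → 9 * K * S + r + 9 * K * (l * b) ≡ 9 * K * (S + l * b) + r
  ring₅ = solve-∀
  cancelled : ℓ * (9 * K * b + 5 * K * (ℓ * ℓ)) + common ≤
              ℓ * (261 * K * m + 36 * K * a + n * n + 5 * K * n) + 486 * K * (m * m) + common
  cancelled = begin
    ℓ * (9 * K * b + 5 * K * (ℓ * ℓ)) + common
      -- Of the 30 K m ℓ² in 5 K ℓ n², 18 cancel against the edges with two vertices in `L`; the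
      -- other 12 are given away, as 5 K ℓ² is enough to make ℓ small.
      ≤⟨ m≤m+n _ (12 * K * (m * (ℓ * ℓ))) ⟩
    ℓ * (9 * K * b + 5 * K * (ℓ * ℓ)) + common + 12 * K * (m * (ℓ * ℓ))
      ≡⟨ ring₁ K m ℓ b ⟩
    ℓ * (5 * K * (n * n)) + 9 * K * (ℓ * b)
      ≤⟨ +-monoˡ-≤ (9 * K * (ℓ * b)) hdeg ⟩
    9 * K * S + ℓ * (n * n + 5 * K * n) + 9 * K * (ℓ * b)
      ≡⟨ ring₅ K S ℓ b (ℓ * (n * n + 5 * K * n)) ⟩
    9 * K * (S + ℓ * b) + ℓ * (n * n + 5 * K * n)
      ≤⟨ +-monoˡ-≤ (ℓ * (n * n + 5 * K * n)) (*-monoʳ-≤ (9 * K) hsum) ⟩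
    9 * K * (2 * (m * (ℓ * ℓ + 12 * ℓ)) + (ℓ * (5 * (m * m) + 4 * a + 5 * m) + 54 * (m * m))) + ℓ * (n * n + 5 * K * n)
      ≡⟨ ring₂ K m ℓ a n ⟩
    ℓ * (261 * K * m + 36 * K * a + n * n + 5 * K * n) + 486 * K * (m * m) + common ∎

module OffCentre {n : ℕ} (H : Hypergraph3 n) {M : List (Triple n)}
                 (mat : Matching H M) (max : Maximum H M) where

  open Counting H mat max public
  open import Data.List.Membership.DecPropositional (_≟ꟳ_ {n}) using () renaming (_∈?_ to _∈ᵥ?_)

  abstract
    bad⇒ : ∀ e f → bad e f ≡ false → e ≢ f × ∃ λ a → ∃ λ c → Cross (γ e f) a c
    bad⇒ e f h with e ≟₃ f
    ... | no e≢f = e≢f , hasCross⇒Cross (γ e f) (not-false (hasCross (γ e f)) h)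
      where
      not-false : ∀ b → not b ≡ false → b ≡ true
      not-false true _ = refl

    bad-or-good : ∀ e f → bad e f ≡ true ⊎ bad e f ≡ false
    bad-or-good e f with bad e f
    ... | true  = inj₁ refl
    ... | false = inj₂ refl

  -- One reference edge with at most the average number of bad partners assigns all the centres:
  -- that of f is read off the cross between e₀ and f. The average guarantees that few edges are
  -- missed.
  module Reference {e₀ : Triple n} (e₀∈ : e₀ ∈ M) (few : m * ∑ M (λ f → ⟦ bad e₀ f ⟧) ≤ #bad) where

    abstract
      centreFrom : ∀ f → bad e₀ f ≡ true ⊎ bad e₀ f ≡ false → Fin 3
      -- A default value: every pair containing such an f is `off`, so its cross is never consulted.
      centreFrom f (inj₁ _) = 0F
      centreFrom f (inj₂ h) = proj₁ (proj₂ (proj₂ (bad⇒ e₀ f h)))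

      centre : Triple n → Fin 3
      centre f = centreFrom f (bad-or-good e₀ f)

      centre-cross : ∀ {f} → bad e₀ f ≡ false → e₀ ≢ f × ∃ λ a → Cross (γ e₀ f) a (centre f)
      centre-cross {f} h = from (bad-or-good e₀ f)
        where
        from : ∀ d → e₀ ≢ f × ∃ λ a → Cross (γ e₀ f) a (centreFrom f d)
        from (inj₁ h′) with () ← trans (sym h′) h
        from (inj₂ h′) = let p , a , _ , x = bad⇒ e₀ f h′ in p , a , x

    off : Triple n → Triple n → Bool
    off e f = bad e₀ e ∨ bad e₀ f ∨ bad e f

    ∨-false : ∀ a {b} → a ∨ b ≡ false → a ≡ false × b ≡ false
    ∨-false false h = refl , h

    -- Consistency in the triangle e, e₀, f, applied at e and at f, identifies the cross of e and f
    -- with the centres assigned through e₀.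
    off⇒ : ∀ {e f} → e ∈ M → f ∈ M → off e f ≡ false → e ≢ f × Cross (γ e f) (centre e) (centre f)
    off⇒ {e} {f} e∈ f∈ h = combine
        (centre-cross (proj₁ (∨-false (bad e₀ e) h)))
        (centre-cross (proj₁ (∨-false (bad e₀ f) h′)))
        (bad⇒ e f (proj₂ (∨-false (bad e₀ f) h′)))
      where
      h′ : bad e₀ f ∨ bad e f ≡ false
      h′ = proj₂ (∨-false (bad e₀ e) h)
      combine : (e₀ ≢ e × ∃ λ a → Cross (γ e₀ e) a (centre e)) →
                (e₀ ≢ f × ∃ λ a → Cross (γ e₀ f) a (centre f)) →
                (e ≢ f × ∃ λ b → ∃ λ c → Cross (γ e f) b c) →
                e ≢ f × Cross (γ e f) (centre e) (centre f)
      combine (e₀≢e , _ , x₁) (e₀≢f , _ , x₂) (e≢f , b , c , x) = e≢f , subst₂ (Cross (γ e f))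
        (sym (centre-consistent e∈ e₀∈ f∈ (≢-sym e₀≢e) e≢f e₀≢f (Cross-flip {e₀} {e} x₁) x x₂))
        (sym (centre-consistent f∈ e₀∈ e∈ (≢-sym e₀≢f) (≢-sym e≢f) e₀≢e
               (Cross-flip {e₀} {f} x₂) (Cross-flip {e} {f} x) x₁)) x

    #off : ℕ
    #off = ∑ M λ e → ∑ M λ f → ⟦ off e f ⟧

    #off≤ : #off ≤ 3 * #bad
    #off≤ = begin
      #off
        ≤⟨ ∑-mono M (λ e → ∑-mono M λ f → union (bad e₀ e) (bad e₀ f) (bad e f)) ⟩
      ∑ M (λ e → ∑ M λ f → ⟦ bad e₀ e ⟧ + (⟦ bad e₀ f ⟧ + ⟦ bad e f ⟧))
        ≡⟨ ∑-cong M (λ e → trans (∑-+ M _ _) (cong₂ _+_ (∑-const M _) (∑-+ M _ _))) ⟩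
      ∑ M (λ e → m * ⟦ bad e₀ e ⟧ + (d + ∑ M λ f → ⟦ bad e f ⟧))
        ≡⟨ trans (∑-+ M _ _) (cong₂ _+_ (∑-*ˡ M m _) (trans (∑-+ M _ _) (cong (_+ #bad) (∑-const M d)))) ⟩
      m * d + (m * d + #bad)
        ≤⟨ +-mono-≤ few (+-mono-≤ few ≤-refl) ⟩
      #bad + (#bad + #bad)
        ≡⟨ ring #bad ⟩
      3 * #bad ∎
      where
      open ≤-Reasoning
      d : ℕ
      d = ∑ M (λ f → ⟦ bad e₀ f ⟧)
      ring : ∀ x → x + (x + x) ≡ 3 * x
      ring = solve-∀
      union : ∀ a b c → ⟦ a ∨ b ∨ c ⟧ ≤ ⟦ a ⟧ + (⟦ b ⟧ + ⟦ c ⟧)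
      union true  _     _ = s≤s z≤n
      union false true  _ = s≤s z≤n
      union false false c = ≤-refl

    off₁ off₂ : Triple n → Fin 3
    off₁ e = other (centre e)
    off₂ e = third (centre e) (other (centre e))

    offCentre : Triple n → List (Fin n)
    offCentre e = at e (off₁ e) ∷ at e (off₂ e) ∷ []

    ∈-offCentre : ∀ {e x} → x ∈ offCentre e → ∃ λ i → centre e ≢ i × x ≡ at e i
    ∈-offCentre {e} (here refl) = off₁ e , other-≢ (centre e) , refl
    ∈-offCentre {e} (there (here refl)) = off₂ e , ≢-third (centre e) , refl
      where
      ≢-third : ∀ c → c ≢ third c (other c)
      ≢-third 0F ()
      ≢-third 1F ()
      ≢-third 2F ()

    off₁≢off₂ : ∀ e → off₁ e ≢ off₂ e
    off₁≢off₂ e = lemma (centre e)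
      where
      lemma : ∀ c → other c ≢ third c (other c)
      lemma 0F ()
      lemma 1F ()
      lemma 2F ()

    vertexList : List (Fin n)
    vertexList = concatMap offCentre M

    -- Edges with a default centre also contribute two vertices, which keeps 2 m ≤ |B| independent
    -- of the bad pairs.
    B : Subset n
    B = Vec.tabulate (λ v → does (v ∈ᵥ? vertexList))

    ∈B⇒ : ∀ x → x ∈ₛ B → x ∈ vertexList
    ∈B⇒ x x∈ with x ∈ᵥ? vertexList | trans (sym (lookup∘tabulate (λ v → does (v ∈ᵥ? vertexList)) x)) ([]=⇒lookup x∈)
    ... | yes p | _ = p

    2m≤∣B∣ : 2 * m ≤ ∣ B ∣
    2m≤∣B∣ = begin
      2 * m
        ≡⟨ trans (*-comm 2 m) (sym (∑-const M 2)) ⟩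
      ∑ M (λ _ → 2)
        ≤⟨ ∑-mono-∈ M two ⟩
      ∑ M (λ e → ∑ (allFin 3) λ i → ⟦ Vec.lookup B (at e i) ⟧)
        ≤⟨ m≤n+m _ _ ⟩
      ∑ L (λ v → ⟦ Vec.lookup B v ⟧) + ∑ M (λ e → ∑ (allFin 3) λ i → ⟦ Vec.lookup B (at e i) ⟧)
        ≡⟨ sym (∑-partition (λ v → ⟦ Vec.lookup B v ⟧)) ⟩
      ∑ (allFin n) (λ v → ⟦ Vec.lookup B v ⟧)
        ≡⟨ sym (∣∣≡∑ B) ⟩
      ∣ B ∣ ∎
      where
      open ≤-Reasoning
      in-B : ∀ {e x} → e ∈ M → x ∈ offCentre e → ⟦ Vec.lookup B x ⟧ ≡ 1
      in-B {e} {x} e∈ x∈ = trans (cong ⟦_⟧ (lookup∘tabulate (λ v → does (v ∈ᵥ? vertexList)) x)) listed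
        where
        listed : ⟦ does (x ∈ᵥ? vertexList) ⟧ ≡ 1
        listed with x ∈ᵥ? vertexList
        ... | yes _ = refl
        ... | no ¬p = contradiction (∈-concat⁺′ x∈ (∈-map⁺ offCentre e∈)) ¬p
      two : ∀ e → e ∈ M → 2 ≤ ∑ (allFin 3) (λ i → ⟦ Vec.lookup B (at e i) ⟧)
      two e e∈ = ≤-trans
        (≤-reflexive (sym (cong₂ _+_ (in-B e∈ (here refl)) (in-B e∈ (there (here refl))))))
        (∈∈⇒+≤∑ (λ i → ⟦ Vec.lookup B (at e i) ⟧) (∈-allFin (off₁ e)) (∈-allFin (off₂ e)) (off₁≢off₂ e))

    weight : Triple n → Triple n → Triple n → ℕ
    weight e f g = ⟦ off e f ⟧ + (⟦ off e g ⟧ + ⟦ off f g ⟧)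

    edge≤weight : ∀ {e f g x y z} → e ∈ M → f ∈ M → g ∈ M →
      x ∈ offCentre e → y ∈ offCentre f → z ∈ offCentre g → ⟦ E H x y z ⟧ ≤ weight e f g
    edge≤weight {e} {f} {g} e∈ f∈ g∈ x∈ y∈ z∈ with off e f in ef | off e g in eg | off f g in fg
    ... | true  | _     | _     = ≤-trans (⟦⟧≤1 _) (s≤s z≤n)
    ... | false | true  | _     = ≤-trans (⟦⟧≤1 _) (s≤s z≤n)
    ... | false | false | true  = ⟦⟧≤1 _
    ... | false | false | false = absent (∈-offCentre x∈) (∈-offCentre y∈) (∈-offCentre z∈)
      where
      absent : ∀ {x y z} → (∃ λ i → centre e ≢ i × x ≡ at e i) → (∃ λ j → centre f ≢ j × y ≡ at f j) →
        (∃ λ k → centre g ≢ k × z ≡ at g k) → ⟦ E H x y z ⟧ ≤ 0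
      absent (i , c≢i , refl) (j , c≢j , refl) (k , c≢k , refl) with E H (at e i) (at f j) (at g k) in h
      ... | false = z≤n
      ... | true  =
        ⊥-elim (no-edge-off-centres e∈ f∈ g∈ (proj₁ xef) (proj₁ xeg) (proj₁ xfg)
                  (proj₂ xef) (proj₂ xeg) (proj₂ xfg) c≢i c≢j c≢k h)
        where
        xef : e ≢ f × Cross (γ e f) (centre e) (centre f)
        xef = off⇒ e∈ f∈ ef
        xeg : e ≢ g × Cross (γ e g) (centre e) (centre g)
        xeg = off⇒ e∈ g∈ eg
        xfg : f ≢ g × Cross (γ f g) (centre f) (centre g)
        xfg = off⇒ f∈ g∈ fg

    ∑-weight : ∑ M (λ e → ∑ M λ f → ∑ M λ g → weight e f g) ≡ 3 * (m * #off)
    ∑-weight = begin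
      ∑ M (λ e → ∑ M λ f → ∑ M λ g → weight e f g)
        ≡⟨ ∑-cong M (λ e → ∑-cong M λ f → trans (∑-+ M _ _) (cong₂ _+_ (∑-const M _) (∑-+ M _ _))) ⟩
      ∑ M (λ e → ∑ M λ f → m * ⟦ off e f ⟧ + (o e + o f))
        ≡⟨ ∑-cong M (λ e → trans (∑-+ M _ _) (cong₂ _+_ (∑-*ˡ M m _) (trans (∑-+ M _ _) (cong (_+ #off) (∑-const M (o e)))))) ⟩
      ∑ M (λ e → m * o e + (m * o e + #off))
        ≡⟨ trans (∑-+ M _ _) (cong₂ _+_ (∑-*ˡ M m o) (trans (∑-+ M _ _) (cong₂ _+_ (∑-*ˡ M m o) (∑-const M #off)))) ⟩
      m * #off + (m * #off + m * #off)
        ≡⟨ ring (m * #off) ⟩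
      3 * (m * #off) ∎
      where
      open ≡-Reasoning
      o : Triple n → ℕ
      o e = ∑ M λ f → ⟦ off e f ⟧
      ring : ∀ x → x + (x + x) ≡ 3 * x
      ring = solve-∀

    -- 72 = 2³ · 3 · 3: two off-centre vertices on each of three edges, three pairs among them that
    -- may be `off`, and `#off≤`.
    inducedEdges-B : inducedEdges H B ≤ 72 * (m * #bad)
    inducedEdges-B = begin
      inducedEdges H B
        ≤⟨ inducedEdges≤ H B vertexList ∈B⇒ ⟩
      ∑ vertexList (λ x → ∑ vertexList λ y → ∑ vertexList λ z → ⟦ E H x y z ⟧)
        ≤⟨ ∑-vertexList {F = λ x → ∑ vertexList λ y → ∑ vertexList λ z → ⟦ E H x y z ⟧} (λ e e∈ x x∈ →
             ∑-vertexList {F = λ y → ∑ vertexList λ z → ⟦ E H x y z ⟧} (λ f f∈ y y∈ →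
             ∑-vertexList {F = λ z → ⟦ E H x y z ⟧} (λ g g∈ z z∈ →
               edge≤weight e∈ f∈ g∈ x∈ y∈ z∈))) ⟩
      ∑ M (λ e → 2 * ∑ M λ f → 2 * ∑ M λ g → 2 * weight e f g)
        ≡⟨ trans (∑-*ˡ M 2 _) (cong (2 *_) (∑-cong M λ e → trans (∑-*ˡ M 2 _) (cong (2 *_) (∑-cong M λ f → ∑-*ˡ M 2 _)))) ⟩
      2 * ∑ M (λ e → 2 * ∑ M λ f → 2 * ∑ M λ g → weight e f g)
        ≡⟨ cong (2 *_) (trans (∑-*ˡ M 2 _) (cong (2 *_) (trans (∑-cong M λ e → ∑-*ˡ M 2 _) (trans (∑-*ˡ M 2 _) (cong (2 *_) ∑-weight))))) ⟩
      2 * (2 * (2 * (3 * (m * #off))))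
        ≤⟨ *-monoʳ-≤ 2 (*-monoʳ-≤ 2 (*-monoʳ-≤ 2 (*-monoʳ-≤ 3 (*-monoʳ-≤ m #off≤)))) ⟩
      2 * (2 * (2 * (3 * (m * (3 * #bad)))))
        ≡⟨ ring m #bad ⟩
      72 * (m * #bad) ∎
      where
      open ≤-Reasoning
      ring : ∀ m b → 2 * (2 * (2 * (3 * (m * (3 * b))))) ≡ 72 * (m * b)
      ring = solve-∀
      ∑-vertexList : ∀ {F : Fin n → ℕ} {w : Triple n → ℕ} →
        (∀ e → e ∈ M → ∀ x → x ∈ offCentre e → F x ≤ w e) → ∑ vertexList F ≤ ∑ M (λ e → 2 * w e)
      ∑-vertexList {F} h = ≤-trans (≤-reflexive (∑-concatMap offCentre M F))
        (∑-mono-∈ M λ e e∈ → ∑-bound (offCentre e) (h e e∈))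

-- From the degree condition to few bad pairs and a small leftover.

module SparseSet {n : ℕ} (H : Hypergraph3 n) {M : List (Triple n)}
             (mat : Matching H M) (max : Maximum H M) where

  open OffCentre H mat max public

  -- In `min-degree`, cleared of fractions, n² absorbs the loss 10 η and 5 k² n the difference
  -- between n² and 2 (n C 2). The two largeness conditions dispose of the arcs and of the
  -- lower-order terms.
  module _ (k q : ℕ) (2≤k : 2 ≤ k) (0<n : 0 < n) (n≤qℓ : n ≤ q * ℓ)
           (n-large₁ : 216 * (k * k) * (216 * (k * k)) ≤ n)
           (n-large₂ : k * k * (266 + 486 * q) ≤ n)
           (min-degree : ∀ v → 5 * (k * k) * (n * n) ≤ 9 * (k * k) * orderedDeg H v + (n * n + 5 * (k * k) * n)) where

    private
      K : ℕ
      K = k * k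

    0<ℓ : 0 < ℓ
    0<ℓ = n≢0⇒n>0 λ ℓ≡0 → <⇒≱ 0<n (≤-trans n≤qℓ (≤-reflexive (trans (cong (q *_) ℓ≡0) (*-zeroʳ q))))

    m≤n : m ≤ n
    m≤n = ≤-trans (m≤m+n m _) (≤-trans (m≤n+m (3 * m) ℓ) (≤-reflexive (sym order)))

    few-arcs : 36 * K * #arcs ≤ n * n
    few-arcs = *-cancelˡ-≤ 6 (begin
      6 * (36 * K * #arcs)          ≡⟨ ring₁ K #arcs ⟩
      t * #arcs                     ≤⟨ #arcs-bound t ⟩
      m * (t * t) + 3 * (m * m)     ≤⟨ +-mono-≤ (*-mono-≤ m≤n n-large₁) (*-monoʳ-≤ 3 (*-mono-≤ m≤n m≤n)) ⟩
      n * n + 3 * (n * n)           ≤⟨ m≤m+n _ (2 * (n * n)) ⟩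
      n * n + 3 * (n * n) + 2 * (n * n)  ≡⟨ ring₂ (n * n) ⟩
      6 * (n * n)                   ∎)
      where
      open ≤-Reasoning
      t : ℕ
      -- 6 times 36 K. As t² ≤ n, the right-hand side of `#arcs-bound` is at most 4 n², within 6 n².
      t = 216 * K
      ring₁ : ∀ K a → 6 * (36 * K * a) ≡ 216 * K * a
      ring₁ = solve-∀
      ring₂ : ∀ x → x + 3 * x + 2 * x ≡ 6 * x
      ring₂ = solve-∀

    summed-degree : ℓ * (5 * K * (n * n)) ≤ 9 * K * ∑ L (orderedDeg H) + ℓ * (n * n + 5 * K * n)
    summed-degree = begin
      ℓ * (5 * K * (n * n))
        ≡⟨ sym (∑-const L _) ⟩
      ∑ L (λ _ → 5 * K * (n * n))
        ≤⟨ ∑-mono L min-degree ⟩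
      ∑ L (λ v → 9 * K * orderedDeg H v + (n * n + 5 * K * n))
        ≡⟨ trans (∑-+ L _ _) (cong₂ _+_ (∑-*ˡ L (9 * K) (orderedDeg H)) (∑-const L _)) ⟩
      9 * K * ∑ L (orderedDeg H) + ℓ * (n * n + 5 * K * n) ∎
      where open ≤-Reasoning

    bad-and-leftover : 9 * K * #bad + 5 * K * (ℓ * ℓ) ≤ 3 * (n * n)
    bad-and-leftover = degree-arithmetic K q n m ℓ #bad #arcs (∑ L (orderedDeg H))
      order 0<ℓ n≤qℓ summed-degree degree-sum few-arcs n-large₂

    few-bad : K * #bad ≤ n * n
    few-bad = *-cancelˡ-≤ 9 (begin
      9 * (K * #bad)                       ≡⟨ sym (*-assoc 9 K #bad) ⟩
      9 * K * #bad                         ≤⟨ m≤m+n _ _ ⟩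
      9 * K * #bad + 5 * K * (ℓ * ℓ)       ≤⟨ bad-and-leftover ⟩
      3 * (n * n)                          ≤⟨ *-monoˡ-≤ (n * n) (m≤m+n 3 6) ⟩
      9 * (n * n)                          ∎)
      where open ≤-Reasoning

    small-leftover : k * ℓ ≤ n
    small-leftover = squares-≤ (*-cancelˡ-≤ 5 (begin
      5 * (k * ℓ * (k * ℓ))                ≡⟨ ring k ℓ ⟩
      5 * K * (ℓ * ℓ)                      ≤⟨ m≤n+m _ (9 * K * #bad) ⟩
      9 * K * #bad + 5 * K * (ℓ * ℓ)       ≤⟨ bad-and-leftover ⟩
      3 * (n * n)                          ≤⟨ *-monoˡ-≤ (n * n) (m≤m+n 3 2) ⟩
      5 * (n * n)                          ∎))
      where
      open ≤-Reasoning
      ring : ∀ k l → 5 * (k * l * (k * l)) ≡ 5 * (k * k) * (l * l)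
      ring = solve-∀

    -- Without matching edges ℓ = n, against k ℓ ≤ n and k ≥ 2. This provides the reference edge.
    0<m : 0 < m
    0<m = n≢0⇒n>0 λ m≡0 → <⇒≱ 0<n (≤-trans (n≡ℓ⇒n≤0 (trans order (trans (cong (λ x → ℓ + 3 * x) m≡0) (+-identityʳ ℓ)))) z≤n)
      where
      n≡ℓ⇒n≤0 : n ≡ ℓ → n ≤ 0
      n≡ℓ⇒n≤0 n≡ℓ = +-cancelʳ-≤ ℓ n 0 (begin
        n + ℓ         ≡⟨ cong (_+ ℓ) n≡ℓ ⟩
        ℓ + ℓ         ≡⟨ cong (ℓ +_) (sym (+-identityʳ ℓ)) ⟩
        2 * ℓ         ≤⟨ *-monoˡ-≤ ℓ 2≤k ⟩
        k * ℓ         ≤⟨ small-leftover ⟩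
        n             ≡⟨ n≡ℓ ⟩
        ℓ             ∎)
        where open ≤-Reasoning

    sparse-set : ∃ λ (B : Subset n) →
      2 * m ≤ ∣ B ∣ × k * ℓ ≤ n × k * k * inducedEdges H B ≤ 72 * (n * (n * n))
    sparse-set = from (∃-≤average M (λ e → ∑ M λ f → ⟦ bad e f ⟧) 0<m)
      where
      ring : ∀ K m b → K * (72 * (m * b)) ≡ 72 * (m * (K * b))
      ring = solve-∀
      from : (∃ λ e₀ → e₀ ∈ M × m * ∑ M (λ f → ⟦ bad e₀ f ⟧) ≤ #bad) →
             ∃ λ (B : Subset n) → 2 * m ≤ ∣ B ∣ × k * ℓ ≤ n × k * k * inducedEdges H B ≤ 72 * (n * (n * n))
      from (e₀ , e₀∈ , few) = B , 2m≤∣B∣ , small-leftover , (begin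
        K * inducedEdges H B    ≤⟨ *-monoʳ-≤ K inducedEdges-B ⟩
        K * (72 * (m * #bad))   ≡⟨ ring K m #bad ⟩
        72 * (m * (K * #bad))   ≤⟨ *-monoʳ-≤ 72 (*-mono-≤ m≤n few-bad) ⟩
        72 * (n * (n * n))      ∎)
        where
        open Reference e₀∈ few
        open ≤-Reasoning

-- Passage to rationals

open import Data.Integer using (+_; +[1+_]; -[1+_])

toSubset : Triple n → Subset n
toSubset t = trio (at t 0F) (at t 1F) (at t 2F)

∈-toSubset⁻ : ∀ (t : Triple n) {x} → x ∈ₛ toSubset t → ∃ λ i → x ≡ at t i
∈-toSubset⁻ t x∈ with x∈p∪q⁻ ⁅ at t 0F ⁆ _ x∈
... | inj₁ p = 0F , x∈⁅y⁆⇒x≡y _ p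
... | inj₂ q with x∈p∪q⁻ ⁅ at t 1F ⁆ ⁅ at t 2F ⁆ q
...   | inj₁ p = 1F , x∈⁅y⁆⇒x≡y _ p
...   | inj₂ p = 2F , x∈⁅y⁆⇒x≡y _ p

∈-toSubset⁺ : ∀ (t : Triple n) i → at t i ∈ₛ toSubset t
∈-toSubset⁺ t 0F = x∈p∪q⁺ (inj₁ (x∈⁅x⁆ _))
∈-toSubset⁺ t 1F = x∈p∪q⁺ {p = ⁅ at t 0F ⁆} (inj₂ (x∈p∪q⁺ (inj₁ (x∈⁅x⁆ _))))
∈-toSubset⁺ t 2F = x∈p∪q⁺ {p = ⁅ at t 0F ⁆} (inj₂ (x∈p∪q⁺ {p = ⁅ at t 1F ⁆} (inj₂ (x∈⁅x⁆ _))))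

toSubset-disjoint : ∀ {s t : Triple n} → VertexDisjoint s t → Disjoint (toSubset s) (toSubset t)
toSubset-disjoint {s = s} {t} d = Empty-unique λ (x , x∈) →
  let p , q   = x∈p∩q⁻ (toSubset s) (toSubset t) x∈
      i , e   = ∈-toSubset⁻ s p
      j , e′  = ∈-toSubset⁻ t q
  in d i j (trans (sym e) e′)

∈-⋃ : ∀ {M : List (Triple n)} {e i} → e ∈ M → at e i ∈ₛ ⋃ (map toSubset M)
∈-⋃ {M = e ∷ M} {i = i} (here refl) = x∈p∪q⁺ (inj₁ (∈-toSubset⁺ e i))
∈-⋃ {M = t ∷ M} (there e∈) = x∈p∪q⁺ {p = toSubset t} (inj₂ (∈-⋃ e∈))

module _ {n : ℕ} (H : Hypergraph3 n) where

  isMatching : ∀ {M} → Matching H M → IsMatching H (map toSubset M)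
  isMatching m = All.map⁺ (areEdges m) ,
    AllPairs.map⁺ (AllPairs.map (λ {s} {t} → toSubset-disjoint {s = s} {t}) (areDisjoint m))

  uncovered≤ : ∀ {M} → Matching H M → uncovered (map toSubset M) ≤ length (leftover M)
  uncovered≤ {M} mat = begin
    ∣ ∁ U ∣
      ≡⟨ ∣∣≡∑ (∁ U) ⟩
    ∑ (allFin n) (λ v → ⟦ Vec.lookup (∁ U) v ⟧)
      ≡⟨ MatchingProperties.∑-partition H mat _ ⟩
    ∑ (leftover M) (λ v → ⟦ Vec.lookup (∁ U) v ⟧) + ∑ M (λ e → ∑ (allFin 3) λ i → ⟦ Vec.lookup (∁ U) (at e i) ⟧)
      ≤⟨ +-mono-≤ (∑-bound (leftover M) λ v _ → ⟦⟧≤1 _) (≤-reflexive (∑-zero M λ e e∈ → ∑-zero (allFin 3) λ i _ → covered {e} {i} e∈)) ⟩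
    length (leftover M) * 1 + 0
      ≡⟨ trans (+-identityʳ _) (*-identityʳ _) ⟩
    length (leftover M) ∎
    where
    open ≤-Reasoning
    U : Subset n
    U = ⋃ (map toSubset M)
    covered : ∀ {e i} → e ∈ M → ⟦ Vec.lookup (∁ U) (at e i) ⟧ ≡ 0
    covered {e} {i} e∈ = cong ⟦_⟧ (trans (lookup-map (at e i) not U) (cong not ([]=⇒lookup (∈-⋃ e∈))))

-- Polynomial forms of the binomial coefficients, without subtraction.

2*nC2+n : ∀ n → 2 * (n C 2) + n ≡ n * n
2*nC2+n zero    = refl
2*nC2+n (suc n) = begin
  2 * (suc n C 2) + suc n          ≡⟨ cong (λ c → 2 * c + suc n) (sym (nCk+nC[k+1]≡[n+1]C[k+1] n 1)) ⟩
  2 * (n C 1 + n C 2) + suc n      ≡⟨ cong (λ c → 2 * (c + n C 2) + suc n) (nC1≡n n) ⟩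
  2 * (n + n C 2) + suc n          ≡⟨ ring₁ n (n C 2) ⟩
  (2 * (n C 2) + n) + (2 * n + 1)  ≡⟨ cong (_+ (2 * n + 1)) (2*nC2+n n) ⟩
  n * n + (2 * n + 1)              ≡⟨ ring₂ n ⟩
  suc n * suc n                    ∎
  where
  open ≡-Reasoning
  ring₁ : ∀ n c → 2 * (n + c) + suc n ≡ (2 * c + n) + (2 * n + 1)
  ring₁ = solve-∀
  ring₂ : ∀ n → n * n + (2 * n + 1) ≡ suc n * suc n
  ring₂ = solve-∀

6*[2+x]C3 : ∀ x → 6 * ((2 + x) C 3) ≡ x * (suc x * (2 + x))
6*[2+x]C3 zero    = refl
6*[2+x]C3 (suc x) = +-cancelʳ-≡ (3 * (2 + x)) _ _ (begin
  6 * ((3 + x) C 3) + 3 * (2 + x)                         ≡⟨ cong (λ c → 6 * c + 3 * (2 + x)) (sym (nCk+nC[k+1]≡[n+1]C[k+1] (2 + x) 2)) ⟩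
  6 * ((2 + x) C 2 + (2 + x) C 3) + 3 * (2 + x)           ≡⟨ ring₁ x ((2 + x) C 2) ((2 + x) C 3) ⟩
  3 * (2 * ((2 + x) C 2) + (2 + x)) + 6 * ((2 + x) C 3)   ≡⟨ cong₂ (λ a b → 3 * a + b) (2*nC2+n (2 + x)) (6*[2+x]C3 x) ⟩
  3 * ((2 + x) * (2 + x)) + x * (suc x * (2 + x))         ≡⟨ ring₂ x ⟩
  suc x * ((2 + x) * (3 + x)) + 3 * (2 + x)               ∎)
  where
  open ≡-Reasoning
  ring₁ : ∀ x c d → 6 * (c + d) + 3 * (2 + x) ≡ 3 * (2 * c + (2 + x)) + 6 * d
  ring₁ = solve-∀
  ring₂ : ∀ x → 3 * ((2 + x) * (2 + x)) + x * (suc x * (2 + x)) ≡ suc x * ((2 + x) * (3 + x)) + 3 * (2 + x)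
  ring₂ = solve-∀

-- With b = x + 2, n + 12 ≤ 2 n ≤ 6 x + 12 gives n ≤ 6 x, so n³ ≤ 6³ x³ and 1296 = 6³ · 6.
cube≤C3 : ∀ {n b} → 12 ≤ n → n ≤ 3 * b → n * (n * n) ≤ 1296 * (b C 3)
cube≤C3 {n} {zero} 12≤n n≤ = contradiction (≤-trans 12≤n n≤) λ ()
cube≤C3 {n} {suc zero} 12≤n n≤ = contradiction (≤-trans 12≤n n≤) λ { (s≤s (s≤s (s≤s ()))) }
cube≤C3 {n} {suc (suc x)} 12≤n n≤ = begin
  n * (n * n)                       ≤⟨ *-mono-≤ n≤6x (*-mono-≤ n≤6x n≤6x) ⟩
  6 * x * (6 * x * (6 * x))         ≡⟨ ring₁ x ⟩
  216 * (x * (x * x))               ≤⟨ *-monoʳ-≤ 216 (*-monoʳ-≤ x (*-mono-≤ (n≤1+n x) (m≤n+m x 2))) ⟩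
  216 * (x * (suc x * (2 + x)))     ≡⟨ cong (216 *_) (sym (6*[2+x]C3 x)) ⟩
  216 * (6 * ((2 + x) C 3))         ≡⟨ sym (*-assoc 216 6 ((2 + x) C 3)) ⟩
  1296 * ((2 + x) C 3)              ∎
  where
  open ≤-Reasoning
  ring₁ : ∀ x → 6 * x * (6 * x * (6 * x)) ≡ 216 * (x * (x * x))
  ring₁ = solve-∀
  ring₂ : ∀ x → 3 * (2 + x) + 3 * (2 + x) ≡ 6 * x + 12
  ring₂ = solve-∀
  n≤6x : n ≤ 6 * x
  n≤6x = +-cancelʳ-≤ 12 n (6 * x) (begin
    n + 12                     ≤⟨ +-mono-≤ n≤ (≤-trans 12≤n n≤) ⟩
    3 * (2 + x) + 3 * (2 + x)  ≡⟨ ring₂ x ⟩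
    6 * x + 12                 ∎)

-- Naturals inside the rationals, and the clearing of denominators.

toℚᵘ-ℕ→ℚ : ∀ k → toℚᵘ (ℕ→ℚ k) ℚᵘ.≃ mkℚᵘ (+ k) 0
toℚᵘ-ℕ→ℚ k = ℚ.toℚᵘ-fromℚᵘ (mkℚᵘ (+ k) 0)

ℕ→ℚ-+ : ∀ a b → ℕ→ℚ (a + b) ≡ ℕ→ℚ a ℚ.+ ℕ→ℚ b
ℕ→ℚ-+ a b = ℚ.toℚᵘ-injective (begin
  toℚᵘ (ℕ→ℚ (a + b))                    ≈⟨ toℚᵘ-ℕ→ℚ (a + b) ⟩
  mkℚᵘ (+ (a + b)) 0                    ≈⟨ *≡* (cong (ℤ._* + 1) (cong₂ ℤ._+_ (sym (ℤ.*-identityʳ (+ a))) (sym (ℤ.*-identityʳ (+ b))))) ⟩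
  mkℚᵘ (+ a) 0 ℚᵘ.+ mkℚᵘ (+ b) 0        ≈⟨ ℚᵘ.≃-sym (ℚᵘ.+-cong (toℚᵘ-ℕ→ℚ a) (toℚᵘ-ℕ→ℚ b)) ⟩
  toℚᵘ (ℕ→ℚ a) ℚᵘ.+ toℚᵘ (ℕ→ℚ b)        ≈⟨ ℚᵘ.≃-sym (ℚ.toℚᵘ-homo-+ (ℕ→ℚ a) (ℕ→ℚ b)) ⟩
  toℚᵘ (ℕ→ℚ a ℚ.+ ℕ→ℚ b)                ∎)
  where open ℚᵘ.≃-Reasoning

ℕ→ℚ-* : ∀ a b → ℕ→ℚ (a * b) ≡ ℕ→ℚ a ℚ.* ℕ→ℚ b
ℕ→ℚ-* a b = ℚ.toℚᵘ-injective (begin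
  toℚᵘ (ℕ→ℚ (a * b))                    ≈⟨ toℚᵘ-ℕ→ℚ (a * b) ⟩
  mkℚᵘ (+ (a * b)) 0                    ≈⟨ *≡* (cong (ℤ._* + 1) (ℤ.pos-* a b)) ⟩
  mkℚᵘ (+ a) 0 ℚᵘ.* mkℚᵘ (+ b) 0        ≈⟨ ℚᵘ.≃-sym (ℚᵘ.*-cong (toℚᵘ-ℕ→ℚ a) (toℚᵘ-ℕ→ℚ b)) ⟩
  toℚᵘ (ℕ→ℚ a) ℚᵘ.* toℚᵘ (ℕ→ℚ b)        ≈⟨ ℚᵘ.≃-sym (ℚ.toℚᵘ-homo-* (ℕ→ℚ a) (ℕ→ℚ b)) ⟩
  toℚᵘ (ℕ→ℚ a ℚ.* ℕ→ℚ b)                ∎)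
  where open ℚᵘ.≃-Reasoning

ℕ→ℚ-mono-≤ : ∀ {a b} → a ≤ b → ℕ→ℚ a ℚ.≤ ℕ→ℚ b
ℕ→ℚ-mono-≤ {a} {b} a≤b = ℚ.toℚᵘ-cancel-≤ (begin
  toℚᵘ (ℕ→ℚ a)   ≃⟨ toℚᵘ-ℕ→ℚ a ⟩
  mkℚᵘ (+ a) 0   ≤⟨ *≤* (ℤ.*-monoʳ-≤-nonNeg (+ 1) (ℤ.+≤+ a≤b)) ⟩
  mkℚᵘ (+ b) 0   ≃⟨ ℚᵘ.≃-sym (toℚᵘ-ℕ→ℚ b) ⟩
  toℚᵘ (ℕ→ℚ b)   ∎)
  where open ℚᵘ.≤-Reasoning

ℕ→ℚ-mono-< : ∀ {a b} → a < b → ℕ→ℚ a ℚ.< ℕ→ℚ b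
ℕ→ℚ-mono-< {a} {b} a<b = ℚ.toℚᵘ-cancel-< (begin-strict
  toℚᵘ (ℕ→ℚ a)   ≃⟨ toℚᵘ-ℕ→ℚ a ⟩
  mkℚᵘ (+ a) 0   <⟨ ℚᵘ.*<* (ℤ.*-monoʳ-<-pos (+ 1) (ℤ.+<+ a<b)) ⟩
  mkℚᵘ (+ b) 0   ≃⟨ ℚᵘ.≃-sym (toℚᵘ-ℕ→ℚ b) ⟩
  toℚᵘ (ℕ→ℚ b)   ∎)
  where open ℚᵘ.≤-Reasoning

ℕ→ℚ-cancel-≤ : ∀ {a b} → ℕ→ℚ a ℚ.≤ ℕ→ℚ b → a ≤ b
ℕ→ℚ-cancel-≤ h = ≮⇒≥ λ b<a → ℚ.<-irrefl refl (ℚ.<-≤-trans (ℕ→ℚ-mono-< b<a) h)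

ℕ→ℚ-nonNeg : ∀ k → ℚ.NonNegative (ℕ→ℚ k)
ℕ→ℚ-nonNeg k = ℚ.nonNegative (ℕ→ℚ-mono-≤ {0} {k} z≤n)

archimedean : ∀ {p} → 0ℚ ℚ.< p → ∃ λ s → 1 ≤ s × 1ℚ ℚ.≤ ℕ→ℚ s ℚ.* p
archimedean {p@(mkℚ +[1+ a ] d-1 _)} _ = suc d-1 , s≤s z≤n , ℚ.toℚᵘ-cancel-≤ (begin
  mkℚᵘ (+ 1) 0                                   ≤⟨ *≤* (ℤ.+≤+ bound) ⟩
  mkℚᵘ (+ suc d-1) 0 ℚᵘ.* mkℚᵘ (+ suc a) d-1     ≃⟨ ℚᵘ.≃-sym (ℚᵘ.*-congʳ {toℚᵘ p} (toℚᵘ-ℕ→ℚ (suc d-1))) ⟩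
  toℚᵘ (ℕ→ℚ (suc d-1)) ℚᵘ.* toℚᵘ p               ≃⟨ ℚᵘ.≃-sym (ℚ.toℚᵘ-homo-* (ℕ→ℚ (suc d-1)) p) ⟩
  toℚᵘ (ℕ→ℚ (suc d-1) ℚ.* p)                     ∎)
  where
  open ℚᵘ.≤-Reasoning
  bound : 1 * (1 * suc d-1) ≤ suc d-1 * suc a * 1
  bound = ≤-trans (≤-reflexive (ring₁ (suc d-1))) (≤-trans (*-monoʳ-≤ (suc d-1) (s≤s (z≤n {a}))) (≤-reflexive (ring₂ (suc d-1) (suc a))))
    where
    ring₁ : ∀ d → 1 * (1 * d) ≡ d * 1
    ring₁ = solve-∀
    ring₂ : ∀ d a → d * a ≡ d * a * 1
    ring₂ = solve-∀
archimedean {mkℚ (+ zero) _ _} (ℚ.*<* (ℤ.+<+ ()))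
archimedean {mkℚ -[1+ _ ] _ _} (ℚ.*<* ())

reciprocal : ∀ D → 0 < D → ∃ λ ε → 0ℚ ℚ.< ε × ℕ→ℚ D ℚ.* ε ≡ 1ℚ
reciprocal D 0<D = ℚ.1/ ℕ→ℚ D , ℚ.positive⁻¹ (ℚ.1/ ℕ→ℚ D) {{ℚ.1/pos⇒pos (ℕ→ℚ D)}} , ℚ.*-inverseʳ (ℕ→ℚ D)
  where
  instance
    D-pos : ℚ.Positive (ℕ→ℚ D)
    D-pos = ℚ.positive (ℕ→ℚ-mono-< 0<D)
    D-nonZero : ℚ.NonZero (ℕ→ℚ D)
    D-nonZero = ℚ.pos⇒nonZero (ℕ→ℚ D)

*-monoˡ-≤ℕ : ∀ k {p q} → p ℚ.≤ q → ℕ→ℚ k ℚ.* p ℚ.≤ ℕ→ℚ k ℚ.* q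
*-monoˡ-≤ℕ k = ℚ.*-monoˡ-≤-nonNeg (ℕ→ℚ k) {{ℕ→ℚ-nonNeg k}}

*-monoʳ-≤ℕ : ∀ k {p q} → p ℚ.≤ q → p ℚ.* ℕ→ℚ k ℚ.≤ q ℚ.* ℕ→ℚ k
*-monoʳ-≤ℕ k = ℚ.*-monoʳ-≤-nonNeg (ℕ→ℚ k) {{ℕ→ℚ-nonNeg k}}

-- Multiplication by 9 K turns the loss 10 η c into 90 K η c, which is at most c.
clear-degree : ∀ K c d η → ℕ→ℚ (90 * K) ℚ.* η ℚ.≤ 1ℚ →
  (+ 5 ℚ./ 9 ℚ.- + 10 ℚ./ 1 ℚ.* η) ℚ.* ℕ→ℚ c ℚ.≤ ℕ→ℚ d → 5 * K * c ≤ 9 * K * d + c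
clear-degree K c d η small h = ℕ→ℚ-cancel-≤ (begin
  ℕ→ℚ (5 * K * c)
    ≡⟨ trans (ℕ→ℚ-* (5 * K) c) (cong (ℚ._* ℕ→ℚ c) (ℕ→ℚ-* 5 K)) ⟩
  ℕ→ℚ 5 ℚ.* ℕ→ℚ K ℚ.* ℕ→ℚ c
    ≡⟨ ring (ℕ→ℚ K) (ℕ→ℚ c) η ⟩
  ℕ→ℚ 9 ℚ.* ℕ→ℚ K ℚ.* ((+ 5 ℚ./ 9 ℚ.- + 10 ℚ./ 1 ℚ.* η) ℚ.* ℕ→ℚ c) ℚ.+ ℕ→ℚ 90 ℚ.* ℕ→ℚ K ℚ.* η ℚ.* ℕ→ℚ c
    ≡⟨ cong₂ (λ a b → a ℚ.* ((+ 5 ℚ./ 9 ℚ.- + 10 ℚ./ 1 ℚ.* η) ℚ.* ℕ→ℚ c) ℚ.+ b ℚ.* η ℚ.* ℕ→ℚ c)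
         (sym (ℕ→ℚ-* 9 K)) (sym (ℕ→ℚ-* 90 K)) ⟩
  ℕ→ℚ (9 * K) ℚ.* ((+ 5 ℚ./ 9 ℚ.- + 10 ℚ./ 1 ℚ.* η) ℚ.* ℕ→ℚ c) ℚ.+ ℕ→ℚ (90 * K) ℚ.* η ℚ.* ℕ→ℚ c
    ≤⟨ ℚ.+-mono-≤ (*-monoˡ-≤ℕ (9 * K) h) (*-monoʳ-≤ℕ c small) ⟩
  ℕ→ℚ (9 * K) ℚ.* ℕ→ℚ d ℚ.+ 1ℚ ℚ.* ℕ→ℚ c
    ≡⟨ cong₂ ℚ._+_ (sym (ℕ→ℚ-* (9 * K) d)) (ℚ.*-identityˡ (ℕ→ℚ c)) ⟩
  ℕ→ℚ (9 * K * d) ℚ.+ ℕ→ℚ c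
    ≡⟨ sym (ℕ→ℚ-+ (9 * K * d) c) ⟩
  ℕ→ℚ (9 * K * d + c) ∎)
  where
  open ℚ.≤-Reasoning
  ring : ∀ x y e → ℕ→ℚ 5 ℚ.* x ℚ.* y ≡
    ℕ→ℚ 9 ℚ.* x ℚ.* ((+ 5 ℚ./ 9 ℚ.- + 10 ℚ./ 1 ℚ.* e) ℚ.* y) ℚ.+ ℕ→ℚ 90 ℚ.* x ℚ.* e ℚ.* y
  ring = solve 3 (λ x y e → con (ℕ→ℚ 5) :* x :* y :=
      con (ℕ→ℚ 9) :* x :* ((con (+ 5 ℚ./ 9) :- con (+ 10 ℚ./ 1) :* e) :* y) :+ con (ℕ→ℚ 90) :* x :* e :* y) refl
    where open +-*-Solver

ordered-min-degree : ∀ {n} (H : Hypergraph3 n) K η → ℕ→ℚ (90 * K) ℚ.* η ℚ.≤ 1ℚ →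
  MinDegAtLeast H ((+ 5 ℚ./ 9 ℚ.- + 10 ℚ./ 1 ℚ.* η) ℚ.* ℕ→ℚ (n C 2)) →
  ∀ v → 5 * K * (n * n) ≤ 9 * K * orderedDeg H v + (n * n + 5 * K * n)
ordered-min-degree {n} H K η small h v = begin
  5 * K * (n * n)
    ≡⟨ cong (5 * K *_) (sym (2*nC2+n n)) ⟩
  5 * K * (2 * c + n)
    ≡⟨ ring₁ K c n ⟩
  2 * (5 * K * c) + 5 * K * n
    ≤⟨ +-monoˡ-≤ (5 * K * n) (*-monoʳ-≤ 2 (clear-degree K c (deg H v) η small (h v))) ⟩
  2 * (9 * K * deg H v + c) + 5 * K * n
    ≡⟨ ring₂ K (deg H v) c n ⟩
  9 * K * (2 * deg H v) + (2 * c + 5 * K * n)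
    ≤⟨ +-mono-≤ (*-monoʳ-≤ (9 * K) (2*deg≤orderedDeg H v))
                (+-monoˡ-≤ (5 * K * n) (≤-trans (m≤m+n (2 * c) n) (≤-reflexive (2*nC2+n n)))) ⟩
  9 * K * orderedDeg H v + (n * n + 5 * K * n) ∎
  where
  open ≤-Reasoning
  c : ℕ
  c = n C 2
  ring₁ : ∀ K c n → 5 * K * (2 * c + n) ≡ 2 * (5 * K * c) + 5 * K * n
  ring₁ = solve-∀
  ring₂ : ∀ K d c n → 2 * (9 * K * d + c) + 5 * K * n ≡ 9 * K * (2 * d) + (2 * c + 5 * K * n)
  ring₂ = solve-∀

-- Since t ≥ 1/η, t² is an integer that can serve as q.
leftover-linear : ∀ n u t η → 1ℚ ℚ.≤ ℕ→ℚ t ℚ.* η → η ℚ.* η ℚ.* ℕ→ℚ n ℚ.≤ ℕ→ℚ u → n ≤ t * t * u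
leftover-linear n u t η big h = ℕ→ℚ-cancel-≤ (begin
  ℕ→ℚ n
    ≡⟨ sym (ℚ.*-identityˡ (ℕ→ℚ n)) ⟩
  1ℚ ℚ.* ℕ→ℚ n
    ≤⟨ *-monoʳ-≤ℕ n big ⟩
  ℕ→ℚ t ℚ.* η ℚ.* ℕ→ℚ n
    ≡⟨ cong (ℚ._* ℕ→ℚ n) (sym (ℚ.*-identityʳ (ℕ→ℚ t ℚ.* η))) ⟩
  ℕ→ℚ t ℚ.* η ℚ.* 1ℚ ℚ.* ℕ→ℚ n
    ≤⟨ *-monoʳ-≤ℕ n (ℚ.*-monoˡ-≤-nonNeg (ℕ→ℚ t ℚ.* η) {{tη-nonNeg}} big) ⟩
  ℕ→ℚ t ℚ.* η ℚ.* (ℕ→ℚ t ℚ.* η) ℚ.* ℕ→ℚ n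
    ≡⟨ ring (ℕ→ℚ t) η (ℕ→ℚ n) ⟩
  ℕ→ℚ t ℚ.* ℕ→ℚ t ℚ.* (η ℚ.* η ℚ.* ℕ→ℚ n)
    ≡⟨ cong (ℚ._* (η ℚ.* η ℚ.* ℕ→ℚ n)) (sym (ℕ→ℚ-* t t)) ⟩
  ℕ→ℚ (t * t) ℚ.* (η ℚ.* η ℚ.* ℕ→ℚ n)
    ≤⟨ *-monoˡ-≤ℕ (t * t) h ⟩
  ℕ→ℚ (t * t) ℚ.* ℕ→ℚ u
    ≡⟨ sym (ℕ→ℚ-* (t * t) u) ⟩
  ℕ→ℚ (t * t * u) ∎)
  where
  open ℚ.≤-Reasoning
  tη-nonNeg : ℚ.NonNegative (ℕ→ℚ t ℚ.* η)
  tη-nonNeg = ℚ.nonNegative (ℚ.≤-trans (ℕ→ℚ-mono-≤ {0} {1} z≤n) big)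
  ring : ∀ x e y → x ℚ.* e ℚ.* (x ℚ.* e) ℚ.* y ≡ x ℚ.* x ℚ.* (e ℚ.* e ℚ.* y)
  ring = solve 3 (λ x e y → x :* e :* (x :* e) :* y := x :* x :* (e :* e :* y)) refl
    where open +-*-Solver

scale-by-α : ∀ a s α → 1ℚ ℚ.≤ ℕ→ℚ s ℚ.* α → ℕ→ℚ a ℚ.≤ α ℚ.* ℕ→ℚ (s * a)
scale-by-α a s α big = begin
  ℕ→ℚ a                         ≡⟨ sym (ℚ.*-identityˡ (ℕ→ℚ a)) ⟩
  1ℚ ℚ.* ℕ→ℚ a                  ≤⟨ *-monoʳ-≤ℕ a big ⟩
  ℕ→ℚ s ℚ.* α ℚ.* ℕ→ℚ a         ≡⟨ ring (ℕ→ℚ s) α (ℕ→ℚ a) ⟩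
  α ℚ.* (ℕ→ℚ s ℚ.* ℕ→ℚ a)       ≡⟨ cong (α ℚ.*_) (sym (ℕ→ℚ-* s a)) ⟩
  α ℚ.* ℕ→ℚ (s * a)             ∎
  where
  open ℚ.≤-Reasoning
  ring : ∀ x e y → x ℚ.* e ℚ.* y ≡ e ℚ.* (x ℚ.* y)
  ring = solve 3 (λ x e y → x :* e :* y := e :* (x :* y)) refl
    where open +-*-Solver

-- 2 m is 2/3 of n - ℓ, and ℓ ≤ s α ℓ ≤ α n.
large-set : ∀ n m ℓ b α s → 0ℚ ℚ.< α → 1ℚ ℚ.≤ ℕ→ℚ s ℚ.* α → n ≡ ℓ + 3 * m → s * ℓ ≤ n → 2 * m ≤ b →
  (+ 2 ℚ./ 3 ℚ.- α) ℚ.* ℕ→ℚ n ℚ.≤ ℕ→ℚ b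
large-set n m ℓ b α s 0<α big eq sℓ≤n 2m≤b = begin
  (+ 2 ℚ./ 3 ℚ.- α) ℚ.* ℕ→ℚ n
    ≡⟨ ring₁ α (ℕ→ℚ n) ⟩
  + 2 ℚ./ 3 ℚ.* ℕ→ℚ n ℚ.- α ℚ.* ℕ→ℚ n
    ≡⟨ cong (λ x → + 2 ℚ./ 3 ℚ.* x ℚ.- α ℚ.* ℕ→ℚ n)
         (trans (cong ℕ→ℚ eq) (trans (ℕ→ℚ-+ ℓ (3 * m)) (cong (ℕ→ℚ ℓ ℚ.+_) (ℕ→ℚ-* 3 m)))) ⟩
  + 2 ℚ./ 3 ℚ.* (ℕ→ℚ ℓ ℚ.+ ℕ→ℚ 3 ℚ.* ℕ→ℚ m) ℚ.- α ℚ.* ℕ→ℚ n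
    ≡⟨ ring₂ (ℕ→ℚ ℓ) (ℕ→ℚ m) (α ℚ.* ℕ→ℚ n) ⟩
  ℕ→ℚ 2 ℚ.* ℕ→ℚ m ℚ.+ (+ 2 ℚ./ 3 ℚ.* ℕ→ℚ ℓ ℚ.- α ℚ.* ℕ→ℚ n)
    ≤⟨ ℚ.+-mono-≤ (ℚ.≤-trans (ℚ.≤-reflexive (sym (ℕ→ℚ-* 2 m))) (ℕ→ℚ-mono-≤ 2m≤b))
                  (ℚ.+-monoˡ-≤ (ℚ.- (α ℚ.* ℕ→ℚ n)) ℓ-bound) ⟩
  ℕ→ℚ b ℚ.+ (α ℚ.* ℕ→ℚ n ℚ.- α ℚ.* ℕ→ℚ n)
    ≡⟨ ring₃ (ℕ→ℚ b) (α ℚ.* ℕ→ℚ n) ⟩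
  ℕ→ℚ b ∎
  where
  open ℚ.≤-Reasoning
  ring₁ : ∀ a x → (+ 2 ℚ./ 3 ℚ.- a) ℚ.* x ≡ + 2 ℚ./ 3 ℚ.* x ℚ.- a ℚ.* x
  ring₁ = solve 2 (λ a x → (con (+ 2 ℚ./ 3) :- a) :* x := con (+ 2 ℚ./ 3) :* x :- a :* x) refl
    where open +-*-Solver
  ring₂ : ∀ l x a → + 2 ℚ./ 3 ℚ.* (l ℚ.+ ℕ→ℚ 3 ℚ.* x) ℚ.- a ≡ ℕ→ℚ 2 ℚ.* x ℚ.+ (+ 2 ℚ./ 3 ℚ.* l ℚ.- a)
  ring₂ = solve 3 (λ l x a → con (+ 2 ℚ./ 3) :* (l :+ con (ℕ→ℚ 3) :* x) :- a :=
                             con (ℕ→ℚ 2) :* x :+ (con (+ 2 ℚ./ 3) :* l :- a)) refl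
    where open +-*-Solver
  ring₃ : ∀ b a → b ℚ.+ (a ℚ.- a) ≡ b
  ring₃ = solve 2 (λ b a → b :+ (a :- a) := b) refl
    where open +-*-Solver
  ℓ-bound : + 2 ℚ./ 3 ℚ.* ℕ→ℚ ℓ ℚ.≤ α ℚ.* ℕ→ℚ n
  ℓ-bound = begin
    + 2 ℚ./ 3 ℚ.* ℕ→ℚ ℓ     ≤⟨ *-monoʳ-≤ℕ ℓ {+ 2 ℚ./ 3} {1ℚ} (ℚ.*≤* (ℤ.+≤+ (s≤s (s≤s z≤n)))) ⟩
    1ℚ ℚ.* ℕ→ℚ ℓ            ≡⟨ ℚ.*-identityˡ (ℕ→ℚ ℓ) ⟩
    ℕ→ℚ ℓ                   ≤⟨ scale-by-α ℓ s α big ⟩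
    α ℚ.* ℕ→ℚ (s * ℓ)       ≤⟨ ℚ.*-monoˡ-≤-nonNeg α {{ℚ.nonNegative (ℚ.<⇒≤ 0<α)}} (ℕ→ℚ-mono-≤ sℓ≤n) ⟩
    α ℚ.* ℕ→ℚ n             ∎

-- After one factor c (2 s) ≥ 1 is dropped, c cancels and leaves 2 s X ≤ D. The spare 2 makes the
-- conclusion strict, as D is positive.
sparse : ∀ c s X D n³ → 0 < c → 0 < s → 0 < D →
  c * (2 * s) * (c * (2 * s)) * X ≤ 72 * n³ → 72 * n³ ≤ c * D → s * X < D
sparse c s X D n³ 0<c 0<s 0<D h₁ h₂ = ≰⇒> λ D≤sX → <⇒≱ 0<D (+-cancelʳ-≤ D D 0 (begin
  D + D                ≤⟨ +-mono-≤ D≤sX D≤sX ⟩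
  s * X + s * X        ≡⟨ ring₁ s X ⟩
  2 * s * X            ≤⟨ *-cancelˡ-≤ c {{>-nonZero 0<c}} scaled ⟩
  D                    ∎))
  where
  open ≤-Reasoning
  k : ℕ
  k = c * (2 * s)
  1≤k : 1 ≤ k
  1≤k = *-mono-≤ 0<c (*-mono-≤ {1} {2} (s≤s z≤n) 0<s)
  ring₁ : ∀ s X → s * X + s * X ≡ 2 * s * X
  ring₁ = solve-∀
  ring₂ : ∀ c s X → c * (2 * s * X) ≡ 1 * (c * (2 * s)) * X
  ring₂ = solve-∀
  scaled : c * (2 * s * X) ≤ c * D
  scaled = begin
    c * (2 * s * X)   ≡⟨ ring₂ c s X ⟩
    1 * k * X         ≤⟨ *-monoˡ-≤ X (*-monoˡ-≤ k 1≤k) ⟩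
    k * k * X         ≤⟨ h₁ ⟩
    72 * n³           ≤⟨ h₂ ⟩
    c * D             ∎

sparse-ℚ : ∀ X D s α → 0ℚ ℚ.< α → 1ℚ ℚ.≤ ℕ→ℚ s ℚ.* α → s * X < D → ℕ→ℚ X ℚ.< α ℚ.* ℕ→ℚ D
sparse-ℚ X D s α 0<α big lt = ℚ.≤-<-trans (scale-by-α X s α big)
  (ℚ.*-monoʳ-<-pos α {{ℚ.positive 0<α}} (ℕ→ℚ-mono-< lt))

n≤3b : ∀ n m ℓ b → n ≡ ℓ + 3 * m → 2 * ℓ ≤ n → 2 * m ≤ b → n ≤ 3 * b
n≤3b n m ℓ b eq 2ℓ≤n 2m≤b = +-cancelˡ-≤ n n (3 * b) (begin
  n + n                    ≡⟨ cong₂ _+_ eq eq ⟩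
  ℓ + 3 * m + (ℓ + 3 * m)  ≡⟨ ring ℓ m ⟩
  2 * ℓ + 3 * (2 * m)      ≤⟨ +-mono-≤ 2ℓ≤n (*-monoʳ-≤ 3 2m≤b) ⟩
  n + 3 * b                ∎)
  where
  open ≤-Reasoning
  ring : ∀ l m → l + 3 * m + (l + 3 * m) ≡ 2 * l + 3 * (2 * m)
  ring = solve-∀

-- c combines the 72 of `inducedEdges-B` with the 1296 of `cube≤C3`. It enters as a variable with an
-- equation, so that products with it stay folded. s is an integer at least 1/α.
module _ {n : ℕ} (H : Hypergraph3 n) {M : List (Triple n)} (mat : Matching H M) (max : Maximum H M)
         (α : ℚ) (0<α : 0ℚ ℚ.< α) (s : ℕ) (0<s : 0 < s) (big-s : 1ℚ ℚ.≤ ℕ→ℚ s ℚ.* α)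
         (c : ℕ) (c≡ : c ≡ 72 * 1296) (0<c : 0 < c) (12≤n : 12 ≤ n) where

  private
    k m ℓ : ℕ
    k = c * (2 * s)
    m = length M
    ℓ = length (leftover M)

  extremal-from : (∃ λ (B : Subset n) →
      2 * m ≤ ∣ B ∣ × k * ℓ ≤ n × k * k * inducedEdges H B ≤ 72 * (n * (n * n))) → Extremal H α
  extremal-from (B , 2m≤b , kℓ≤n , few) = B ,
    large-set n m ℓ ∣ B ∣ α s 0<α big-s n≡ (≤-trans (*-monoˡ-≤ ℓ s≤k) kℓ≤n) 2m≤b ,
    sparse-ℚ (inducedEdges H B) (∣ B ∣ C 3) s α 0<α big-s
      (sparse c s (inducedEdges H B) (∣ B ∣ C 3) (n * (n * n)) 0<c 0<s positive few cube)
    where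
    n≡ : n ≡ ℓ + 3 * m
    n≡ = MatchingProperties.order H mat
    2s≤k : 2 * s ≤ k
    2s≤k = ≤-trans (≤-reflexive (sym (*-identityˡ (2 * s)))) (*-monoˡ-≤ (2 * s) 0<c)
    s≤k : s ≤ k
    s≤k = ≤-trans (m≤m+n s _) 2s≤k
    2≤k : 2 ≤ k
    2≤k = ≤-trans (*-monoʳ-≤ 2 0<s) 2s≤k
    n³≤ : n * (n * n) ≤ 1296 * (∣ B ∣ C 3)
    n³≤ = cube≤C3 {n} {∣ B ∣} 12≤n (n≤3b n m ℓ ∣ B ∣ n≡ (≤-trans (*-monoˡ-≤ ℓ 2≤k) kℓ≤n) 2m≤b)
    cube : 72 * (n * (n * n)) ≤ c * (∣ B ∣ C 3)
    cube = subst (λ z → 72 * (n * (n * n)) ≤ z * (∣ B ∣ C 3)) (sym c≡)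
      (≤-trans (*-monoʳ-≤ 72 n³≤) (≤-reflexive (sym (*-assoc 72 1296 (∣ B ∣ C 3)))))
    0<n : 0 < n
    0<n = ≤-trans (s≤s z≤n) 12≤n
    positive : 0 < ∣ B ∣ C 3
    positive = n≢0⇒n>0 λ z → <⇒≱ (*-mono-≤ 0<n (*-mono-≤ 0<n 0<n))
      (≤-trans n³≤ (≤-reflexive (trans (cong (1296 *_) z) (*-zeroʳ 1296))))

  dichotomy : ∀ η t → 1ℚ ℚ.≤ ℕ→ℚ t ℚ.* η → ℕ→ℚ (90 * (k * k)) ℚ.* η ℚ.≤ 1ℚ →
    216 * (k * k) * (216 * (k * k)) ≤ n → k * k * (266 + 486 * (t * t)) ≤ n →
    MinDegAtLeast H ((+ 5 ℚ./ 9 ℚ.- + 10 ℚ./ 1 ℚ.* η) ℚ.* ℕ→ℚ (n C 2)) →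
    HasAlmostPerfectMatching H (η ℚ.* η ℚ.* ℕ→ℚ n) ⊎ Extremal H α
  dichotomy η t big-t small large₁ large₂ h = by-size (ℕ→ℚ (uncovered (map toSubset M)) ℚ.<? bound)
    where
    bound : ℚ
    bound = η ℚ.* η ℚ.* ℕ→ℚ n
    0<n : 0 < n
    0<n = ≤-trans (s≤s z≤n) 12≤n
    2≤k : 2 ≤ k
    2≤k = *-mono-≤ 0<c (*-monoʳ-≤ 2 0<s)
    by-size : Dec (ℕ→ℚ (uncovered (map toSubset M)) ℚ.< bound) → HasAlmostPerfectMatching H bound ⊎ Extremal H α
    by-size (yes lt) = inj₁ (map toSubset M , isMatching H mat , lt)
    by-size (no ≮)   = inj₂ (extremal-from (SparseSet.sparse-set H mat max k (t * t) 2≤k 0<n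
      (leftover-linear n ℓ t η big-t (ℚ.≤-trans (ℚ.≮⇒≥ ≮) (ℕ→ℚ-mono-≤ (uncovered≤ H mat))))
      large₁ large₂ (ordered-min-degree H (k * k) η small h)))

Conclusion : ℚ → ℚ → ℕ → Set
Conclusion α η n = (H : Hypergraph3 n) →
  MinDegAtLeast H ((+ 5 ℚ./ 9 ℚ.- + 10 ℚ./ 1 ℚ.* η) ℚ.* ℕ→ℚ (n C 2)) →
  HasAlmostPerfectMatching H (η ℚ.* η ℚ.* ℕ→ℚ n) ⊎ Extremal H α

theorem2 : Σ ℚ λ α₀ → 0ℚ ℚ.< α₀ ×
    (∀ (α : ℚ) → 0ℚ ℚ.< α → α ℚ.< α₀ →
    Σ ℚ λ η₀ → 0ℚ ℚ.< η₀ ×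
    (∀ (η : ℚ) → 0ℚ ℚ.< η → η ℚ.< η₀ →
    Σ ℕ λ n₀ →
    ∀ (n : ℕ) → n ≥ n₀ → (H : Hypergraph3 n) →
    MinDegAtLeast H ((+ 5 ℚ./ 9 ℚ.- + 10 ℚ./ 1 ℚ.* η) ℚ.* ℕ→ℚ (n C 2)) →
    HasAlmostPerfectMatching H (η ℚ.* η ℚ.* ℕ→ℚ n) ⊎ Extremal H α))
theorem2 = 1ℚ , ℕ→ℚ-mono-< {0} {1} (s≤s z≤n) ,
  λ α 0<α _ → for-α α 0<α (archimedean 0<α) (72 * 1296) refl (s≤s z≤n)
  where
  for-α : ∀ α → 0ℚ ℚ.< α → (∃ λ s → 1 ≤ s × 1ℚ ℚ.≤ ℕ→ℚ s ℚ.* α) → ∀ c → c ≡ 72 * 1296 → 0 < c →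
    Σ ℚ λ η₀ → 0ℚ ℚ.< η₀ × (∀ η → 0ℚ ℚ.< η → η ℚ.< η₀ → Σ ℕ λ n₀ → ∀ n → n ≥ n₀ → Conclusion α η n)
  -- η₀ = 1/(90 k²): below it, the loss 10 η scaled by 9 k² is at most 1.
  for-α α 0<α (s , 0<s , big-s) c c≡ 0<c = for-η (reciprocal (90 * (k * k)) 0<90K)
    where
    k : ℕ
    k = c * (2 * s)
    0<k : 0 < k
    0<k = *-mono-≤ 0<c (*-mono-≤ {1} {2} (s≤s z≤n) 0<s)
    0<90K : 0 < 90 * (k * k)
    0<90K = *-mono-≤ {1} {90} (s≤s z≤n) (*-mono-≤ 0<k 0<k)
    for-η : (∃ λ ε → 0ℚ ℚ.< ε × ℕ→ℚ (90 * (k * k)) ℚ.* ε ≡ 1ℚ) →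
      Σ ℚ λ η₀ → 0ℚ ℚ.< η₀ × (∀ η → 0ℚ ℚ.< η → η ℚ.< η₀ → Σ ℕ λ n₀ → ∀ n → n ≥ n₀ → Conclusion α η n)
    for-η (η₀ , 0<η₀ , inv) = η₀ , 0<η₀ , λ η 0<η η<η₀ → for-n η 0<η η<η₀ (archimedean 0<η)
      where
      for-n : ∀ η → 0ℚ ℚ.< η → η ℚ.< η₀ → (∃ λ t → 1 ≤ t × 1ℚ ℚ.≤ ℕ→ℚ t ℚ.* η) →
        Σ ℕ λ n₀ → ∀ n → n ≥ n₀ → Conclusion α η n
      for-n η 0<η η<η₀ (t , _ , big-t) =
          -- 12 serves `cube≤C3`, n₁ the bound on arcs, n₂ the lower-order terms; only n₂ depends on
          -- η, through t.
          12 + (n₁ + n₂) , λ n n≥ H → from-maximum n≥ H (maximum-matching H)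
        where
        n₁ n₂ : ℕ
        n₁ = 216 * (k * k) * (216 * (k * k))
        n₂ = k * k * (266 + 486 * (t * t))
        from-maximum : ∀ {n} → n ≥ 12 + (n₁ + n₂) → (H : Hypergraph3 n) →
          (∃ λ M → Matching H M × Maximum H M) →
          MinDegAtLeast H ((+ 5 ℚ./ 9 ℚ.- + 10 ℚ./ 1 ℚ.* η) ℚ.* ℕ→ℚ (n C 2)) →
          HasAlmostPerfectMatching H (η ℚ.* η ℚ.* ℕ→ℚ n) ⊎ Extremal H α
        from-maximum n≥ H (M , mat , max) =
          dichotomy H mat max α 0<α s 0<s big-s c c≡ 0<c (≤-trans (m≤m+n 12 _) n≥)
            η t big-t
            (ℚ.≤-trans (*-monoˡ-≤ℕ (90 * (k * k)) (ℚ.<⇒≤ η<η₀)) (ℚ.≤-reflexive inv))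
            (≤-trans (m≤m+n n₁ n₂) (≤-trans (m≤n+m (n₁ + n₂) 12) n≥))
            (≤-trans (m≤n+m n₂ n₁) (≤-trans (m≤n+m (n₁ + n₂) 12) n≥))
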